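{- (a) There is a constant $C>0$ such that for every positive integer $n$ and all sufficiently large $m$, \[ s(m,n,2)\le C\cdot m^{1-\frac{1}{4n+1}}. \] (b) Let $n\ge 4$ be an integer. There is a constant $D>0$ such that for all sufficiently large $m$, \[ s(m,n,2)\ge D\, m^{1-\frac{1}{\lfloor n/4\rfloor}}. \]
   Context: Let $[m]=\{1,\dots,m\}$. An $(m,n,s)$-storing scheme is a map $\phi$ from the family of subsets of $[m]$ of size at most $n$ to $\{0,1\}^s$. An $(m,s,t)$-query scheme is a family $\{T_u\}_{u\in[m]}$ of Boolean decision trees of depth at most $t$: each internal node is marked with an index in $\{1,\dots,s\}$ (the address of a bit of an $s$-bit string), has one outgoing edge labelled $0$ and one labelled $1$, and each leaf is marked Yes or No; $T_u$ thus maps $\{0,1\}^s$ to $\{\mathrm{Yes},\mathrm{No}\}$ by following, from the root, the edges given by the probed bits (probes may be adaptive). An $(m,n,s,t)$-scheme is a pair of an $(m,n,s)$-storing scheme $\phi$ and an $(m,s,t)$-query scheme $\{T_u\}$ such that for every $S\subseteq[m]$ with $|S|\le n$ and every $u\in[m]$, $T_u(\phi(S))=\mathrm{Yes}$ iff $u\in S$. $s(m,n,t)$ denotes the minimum $s$ for which an $(m,n,s,t)$-scheme exists. -}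

module Defs where

open import Data.Nat using (ℕ; suc; _≤_; _⊔_)
open import Data.Bool using (Bool; true; false)
open import Data.Fin using (Fin)
open import Data.Fin.Subset using (Subset; _∈_; ∣_∣)
open import Data.Vec using (Vec; lookup)
open import Data.Product using (Σ; _×_; proj₁)
open import Relation.Binary.PropositionalEquality using (_≡_)
open import Function.Bundles using (_⇔_)

data DTree (s : ℕ) : Set where
  leaf : Bool → DTree s
  node : Fin s → DTree s → DTree s → DTree s

depth : ∀ {s} → DTree s → ℕ
depth (leaf _)     = 0
depth (node _ l r) = suc (depth l ⊔ depth r)

eval : ∀ {s} → DTree s → Vec Bool s → Bool
eval (leaf b)     x = b
eval (node i l r) x with lookup x i
... | false = eval l x
... | true  = eval r x

StoringScheme : ℕ → ℕ → ℕ → Set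
StoringScheme m n s = (S : Subset m) → ∣ S ∣ ≤ n → Vec Bool s

QueryScheme : ℕ → ℕ → ℕ → Set
QueryScheme m s t = (u : Fin m) → Σ (DTree s) (λ T → depth T ≤ t)

record Scheme (m n s t : ℕ) : Set where
  field
    φ       : StoringScheme m n s
    query   : QueryScheme m s t
    correct : (S : Subset m) (h : ∣ S ∣ ≤ n) (u : Fin m) →
              (eval (proj₁ (query u)) (φ S h) ≡ true) ⇔ (u ∈ S)

-- Write I u for the first address probed on query u and J β u for what is probed next after reading
-- the bit β.  Storing S amounts to choosing bits x such that no u ∈ S and v ∉ S agree in
-- x (I u) = x (I v) = β and J β u = J β v: a 2-SAT instance whose clauses say that I u and I v do not
-- both carry β.
--
-- Upper bound: choose the triples (I u, J false u, J true u) as the hyperedges of a 3-partite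
-- hypergraph without cycles of at most 4n + 1 hyperedges, built greedily under a degree bound.  The
-- elements sharing a second cell with a member of S then form a forest, because a cycle among them
-- could be shortcut through a member of S to length at most 4n + 1.  In a forest, removing leaves one
-- by one shows that all elements can even be given pairwise distinct second cells.
--
-- Lower bound: assuming x = 0 at a root address, every cell used there forces the value 1 at the
-- addresses of its other elements, which in turn force 0 elsewhere, and so on.  With all degrees
-- above q > s^(1/r), the forced elements outnumber the cells after r = ⌊n/4⌋ - 1 rounds, so two of
-- them share a cell; storing exactly one of these refutes x = 0, at a cost of 2r + 1 stored elements.
-- The same for x = 1 gives a set of size at most 4r + 2 ≤ n that cannot be stored.
module Submission where

open import Defs
open import Data.Bool using (Bool; true; false; not; if_then_else_)
import Data.Bool.Properties as Boolₚ
open import Data.Fin using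
  (Fin; zero; suc; _≟_; toℕ; splitAt; join; inject≤; punchIn; punchOut; combine; remQuot)
open import Data.Fin.Properties using
  (any?; all?; injective⇒≤; suc-injective; splitAt-join; ¬∀⟶∃¬; punchOut-injective;
   punchIn-injective; punchInᵢ≢i; punchIn-punchOut; inject≤-injective; pigeonhole;
   combine-injective; combine-remQuot; remQuot-combine; toℕ-fromℕ<; toℕ≤pred[n]; <⇒≢)
open import Data.Fin.Subset using (Subset; inside; outside; _∪_; ⁅_⁆; ∣_∣) renaming (_∈_ to _∈ₛ_; ⊥ to ∅)
open import Data.Fin.Subset.Properties using
  (∣⊥∣≡0; ∉⊥; x∈⁅x⁆; x∈⁅y⁆⇒x≡y; ∣⁅x⁆∣≡1; x∈p∪q⁺; x∈p∪q⁻)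
  renaming (_∈?_ to _∈ₛ?_)
open import Data.List as List using (List; []; _∷_; _++_; length; foldr; concatMap; map; allFin)
open import Data.List.Membership.Propositional using (_∈_; _∉_)
import Data.List.Membership.DecPropositional as DecMembership
open import Data.List.Membership.Propositional.Properties using
  (∈-++⁺ˡ; ∈-++⁺ʳ; ∈-++⁻; ∈-map⁺; ∈-allFin; ∈-concatMap⁺)
open import Data.List.Properties using (length-++; length-tabulate)
open import Data.List.Relation.Unary.Any as Any using (here; there; index)
open import Data.List.Relation.Unary.Any.Properties using (lookup-index)
open import Data.Nat using
  (ℕ; zero; suc; _+_; _*_; _^_; _≤_; _<_; _/_; _%_; _∸_; _⊔_; z≤n; s≤s; _≤?_; _<?_; NonZero;
   >-nonZero; >-nonZero⁻¹)
open import Data.Nat.DivMod using (_mod_; m<n⇒m%n≡m; m/n*n≤m; m≡m%n+[m/n]*n; m%n<n; m≥n⇒m/n>0)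
import Data.Nat.Properties as ℕₚ
open import Data.Nat.Tactic.RingSolver using (solve-∀)
open import Data.Product using (Σ; ∃; ∃₂; _×_; _,_; proj₁; proj₂)
open import Data.Product.Properties using (≡-dec; ,-injectiveʳ)
open import Data.Sum using (_⊎_; inj₁; inj₂; [_,_]′)
open import Data.Vec using (Vec; []; _∷_; here; there; lookup; tabulate)
open import Data.Vec.Properties using (lookup∘tabulate)
open import Function using (_∘_; id)
open import Function.Bundles using (_⇔_; mk⇔; Equivalence)
open import Function.Definitions using (Injective)
open import Level using (0ℓ)
open import Relation.Binary.PropositionalEquality
open import Relation.Nullary using (¬_; Dec; yes; no; contradiction; ¬?; does)
open import Relation.Nullary.Decidable using (_×-dec_; _⊎-dec_; decidable-stable; dec-true; map′)
open import Relation.Unary using (Pred; Decidable; ∁; U)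

open Equivalence using (to; from)

-- Decidable predicates on finite sets, and cores of large minimum degree

record Enumeration {n} (P : Pred (Fin n) 0ℓ) : Set where
  field
    size      : ℕ
    elem      : Fin size → Fin n
    injective : Injective _≡_ _≡_ elem
    sound     : ∀ i → P (elem i)
    complete  : ∀ {x} → P x → ∃ λ i → elem i ≡ x

open Enumeration

enumerate : ∀ {n} {P : Pred (Fin n) 0ℓ} → Decidable P → Enumeration P
enumerate {zero} P? = record
  { size = 0 ; elem = λ () ; injective = λ { {()} } ; sound = λ () ; complete = λ { {()} } }
enumerate {suc n} {P} P? with P? zero | enumerate (P? ∘ suc)
... | no ¬p | e = record
  { size = size e
  ; elem = suc ∘ elem e
  ; injective = injective e ∘ suc-injective
  ; sound = sound e
  ; complete = λ { {zero} p → contradiction p ¬p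
                 ; {suc x} p → let i , eq = complete e p in i , cong suc eq }
  }
... | yes p | e = record
  { size = suc (size e)
  ; elem = λ { zero → zero ; (suc i) → suc (elem e i) }
  ; injective = λ { {zero} {zero} _ → refl
                  ; {suc i} {suc j} eq → cong suc (injective e (suc-injective eq)) }
  ; sound = λ { zero → p ; (suc i) → sound e i }
  ; complete = λ { {zero} _ → zero , refl
                 ; {suc x} q → let i , eq = complete e q in suc i , cong suc eq }
  }

count : ∀ {n} {P : Pred (Fin n) 0ℓ} → Decidable P → ℕ
count = size ∘ enumerate

size-cover : ∀ {n} {P : Pred (Fin n) 0ℓ} (P? : Decidable P) (e : Enumeration P) (e′ : Enumeration (∁ P)) →
             n ≤ size e + size e′
size-cover {n} P? e e′ = injective⇒≤ λ {x} {y} eq →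
  trans (sym (decode-encode x)) (trans (cong decode eq) (decode-encode y))
  where
  code : ∀ x → ∃ λ c → [ elem e , elem e′ ]′ c ≡ x
  code x with P? x
  ... | yes p = let i , eq = complete e p in inj₁ i , eq
  ... | no ¬p = let i , eq = complete e′ ¬p in inj₂ i , eq
  encode : Fin n → Fin (size e + size e′)
  encode x = join _ _ (proj₁ (code x))
  decode : Fin (size e + size e′) → Fin n
  decode z = [ elem e , elem e′ ]′ (splitAt (size e) z)
  decode-encode : ∀ x → decode (encode x) ≡ x
  decode-encode x = trans (cong [ elem e , elem e′ ]′ (splitAt-join (size e) _ (proj₁ (code x)))) (proj₂ (code x))

-- A subfamily of points in which every cell that is met at all is met by at least `suc q` points,
-- `ι c β` being the cell of incidence `c` at point `β`. The size is a successor so that there is a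
-- point to start from. A point may occur among its own cellmates.
record Core {L V N} (q : ℕ) (ι : Fin L → Fin N → Fin V) : Set where
  field
    pred-size    : ℕ
    emb          : Fin (suc pred-size) → Fin N
    emb-inj      : Injective _≡_ _≡_ emb
    cellmate     : Fin L → Fin (suc pred-size) → Fin (suc q) → Fin (suc pred-size)
    cellmate-inj : ∀ c β → Injective _≡_ _≡_ (cellmate c β)
    same-cell    : ∀ c β a → ∃ λ c′ → ι c′ (emb (cellmate c β a)) ≡ ι c (emb β)

meets? : ∀ {L V N} (ι : Fin L → Fin N → Fin V) v → Decidable (λ β → ∃ λ c → ι c β ≡ v)
meets? ι v β = any? λ c → ι c β ≟ v

crowded-core : ∀ {L V N q} (ι : Fin L → Fin (suc N) → Fin V) →
               (∀ v → q < count (meets? ι v)) → Core q ι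
crowded-core {N = N} ι large = record
  { pred-size = N ; emb = id ; emb-inj = id
  ; cellmate = λ c β a → elem (e c β) (inject≤ a (large (ι c β)))
  ; cellmate-inj = λ c β eq → inject≤-injective (large (ι c β)) (large (ι c β)) _ _ (injective (e c β) eq)
  ; same-cell = λ c β a → sound (e c β) (inject≤ a (large (ι c β))) }
  where
  e = λ c β → enumerate (meets? ι (ι c β))

-- Repeatedly delete a cell meeting at most q points: a cell is deleted at most once, so fewer
-- than N points are lost in total.
peel : ∀ {L} V {N} q (ι : Fin L → Fin N → Fin V) → V * q < N → Core q ι

peel-cell : ∀ {L} V {N} q (ι : Fin L → Fin N → Fin (suc V)) → suc V * q < N →
            ∀ v → count (meets? ι v) ≤ q → Core q ι
peel-cell V {N} q ι V*q<N v small = record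
  { pred-size = C.pred-size ; emb = elem e ∘ C.emb ; emb-inj = C.emb-inj ∘ injective e
  ; cellmate = C.cellmate ; cellmate-inj = C.cellmate-inj
  ; same-cell = λ c β a → let c′ , eq = C.same-cell c β a in
      c′ , punchOut-injective (avoids c′ (C.emb (C.cellmate c β a))) (avoids c (C.emb β)) eq }
  where
  e = enumerate (λ β → ¬? (meets? ι v β))
  enough : V * q < size e
  enough = ℕₚ.+-cancelˡ-< q _ _ (ℕₚ.<-≤-trans V*q<N (ℕₚ.≤-trans
    (size-cover (meets? ι v) (enumerate (meets? ι v)) e)
    (ℕₚ.+-monoˡ-≤ _ small)))
  avoids : ∀ c β → v ≢ ι c (elem e β)
  avoids c β eq = sound e β (c , sym eq)
  module C = Core (peel V q (λ c β → punchOut (avoids c β)) enough)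

peel zero {suc N} q ι _ = crowded-core ι λ ()
peel (suc V) {suc N} q ι V*q<N = decide (all? λ v → suc q ≤? count (meets? ι v))
  where
  decide : Dec (∀ v → q < count (meets? ι v)) → Core q ι
  decide (yes large) = crowded-core ι large
  decide (no ¬large) =
    let v , small = ¬∀⟶∃¬ _ _ (λ v → suc q ≤? count (meets? ι v)) ¬large in
    peel-cell V q ι V*q<N v (ℕₚ.≮⇒≥ small)

-- Least witnesses, powers, bits and separation

least : ∀ {P : Pred ℕ 0ℓ} → Decidable P → ∀ n → P n → ∃ λ t → t ≤ n × P t × (∀ {t′} → t′ < t → ¬ P t′)
least P? zero p = 0 , z≤n , p , λ ()
least {P} P? (suc n) p with P? 0
... | yes p₀ = 0 , z≤n , p₀ , λ ()
... | no ¬p₀ =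
  let t , t≤n , pt , min = least (P? ∘ suc) n p in
  suc t , s≤s t≤n , pt , λ { {zero} _ → ¬p₀ ; {suc t′} (s≤s t′<t) → min t′<t }

^-distribʳ-* : ∀ n a b → (a * b) ^ n ≡ a ^ n * b ^ n
^-distribʳ-* zero    a b = refl
^-distribʳ-* (suc n) a b = trans (cong (a * b *_) (^-distribʳ-* n a b)) (ℕₚ.[m*n]*[o*p]≡[m*o]*[n*p] a b (a ^ n) (b ^ n))

side : Bool → Fin 2
side false = zero
side true  = suc zero

unside : Fin 2 → Bool
unside zero       = false
unside (suc zero) = true

unside-side : ∀ σ → unside (side σ) ≡ σ
unside-side false = refl
unside-side true  = refl

side-injective : ∀ {a b} → side a ≡ side b → a ≡ b
side-injective {a} {b} eq = trans (sym (unside-side a)) (trans (cong unside eq) (unside-side b))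

subtreeAt : ∀ {s} → Bool → DTree s → DTree s → DTree s
subtreeAt false l r = l
subtreeAt true  l r = r

eval-node : ∀ {s β} i (l r : DTree s) {x} → lookup x i ≡ β → eval (node i l r) x ≡ eval (subtreeAt β l r) x
eval-node {β = false} i l r {x} eq with false ← lookup x i = refl
eval-node {β = true}  i l r {x} eq with true  ← lookup x i = refl

Separates : ∀ {m s V} → (Fin m → Fin s) → (Bool → Fin m → Fin V) → Pred (Fin m) 0ℓ → (Fin s → Bool) → Set
Separates I J T x = ∀ β {u v} → T u → ¬ T v → x (I u) ≡ β → x (I v) ≡ β → J β u ≢ J β v

-- Lower bound

-- The stored set `T` is prescribed on `Reserve` only, where it must coincide with `members`. This
-- is what lets two refutations with disjoint reserves be merged into one set.
record Refutation {m s V} (I : Fin m → Fin s) (J : Bool → Fin m → Fin V)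
                  (ℓ : ℕ) (Reserve : Pred (Fin m) 0ℓ) (h : Fin s) (σ : Bool) : Set₁ where
  field
    members  : List (Fin m)
    bounded  : length members ≤ ℓ
    reserved : ∀ {u} → u ∈ members → Reserve u
    refutes  : ∀ {T x} → Separates I J T x → (∀ {u} → u ∈ members → T u) →
               (∀ {u} → Reserve u → u ∉ members → ¬ T u) → x h ≢ σ

-- The bit at `h` takes one of the two values. By disjointness, adding the members of one refutation
-- does not change the stored set on the reserve of the other.
refute-both : ∀ {m s V} {I : Fin m → Fin s} {J : Bool → Fin m → Fin V} {ℓ ℓ′ R R′ h} →
              Refutation I J ℓ R h false → Refutation I J ℓ′ R′ h true → (∀ {u} → R u → ¬ R′ u) →
              ∃ λ W → length W ≤ ℓ + ℓ′ × (∀ x → ¬ Separates I J (_∈ W) x)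
refute-both {I = I} {J} {h = h} A B disjoint = A.members ++ B.members ,
  ℕₚ.≤-trans (ℕₚ.≤-reflexive (length-++ A.members)) (ℕₚ.+-mono-≤ A.bounded B.bounded) ,
  λ x sep → either x sep (x h) refl
  where
  module A = Refutation A
  module B = Refutation B
  either : ∀ x → Separates I J (_∈ A.members ++ B.members) x → ∀ σ → x h ≢ σ
  either x sep false = A.refutes {x = x} sep ∈-++⁺ˡ λ r ∉A →
    [ ∉A , disjoint r ∘ B.reserved ]′ ∘ ∈-++⁻ A.members
  either x sep true = B.refutes {x = x} sep (∈-++⁺ʳ A.members) λ r ∉B →
    [ (λ ∈A → disjoint (A.reserved ∈A) r) , ∉B ]′ ∘ ∈-++⁻ A.members

-- This supplies children different from their parent, given that a point may be its own cellmate: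
-- drop the index of `β` if there is one, else the first index.
others : ∀ {q N} (g : Fin (suc q) → Fin N) → Injective _≡_ _≡_ g → ∀ β →
         Σ (Fin q → Fin (suc q)) λ h → Injective _≡_ _≡_ h × (∀ a → g (h a) ≢ β)
others g g-inj β with any? (λ p → g p ≟ β)
... | yes (p , gp≡β) = punchIn p , (λ {i} {j} → punchIn-injective p i j) ,
      λ a eq → punchInᵢ≢i p a (g-inj (trans eq (sym gp≡β)))
... | no ∄p = suc , suc-injective , λ a eq → ∄p (suc a , eq)

-- The bundle `β` offers one element for each class `c`, all with the same first address. A bit
-- forced at that address therefore applies to every class, and each use of the bundle can take a
-- fresh element.
record Bundles {m s} (I : Fin m → Fin s) (L b : ℕ) : Set where
  field
    member     : Fin L → Fin b → Fin m
    member-inj : ∀ {c c′ β β′} → member c β ≡ member c′ β′ → c ≡ c′ × β ≡ β′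
    same-home  : ∀ c c′ β → I (member c β) ≡ I (member c′ β)

open Bundles

-- Pigeonhole principle for fibres, read off a core with a single incidence per point: the cellmates
-- of a point lie in its fibre.
crowded-fibre : ∀ {s N q} (f : Fin N → Fin s) → s * q < N →
                ∃₂ λ (g : Fin (suc q) → Fin N) i → Injective _≡_ _≡_ g × (∀ a → f (g a) ≡ i)
crowded-fibre {s} {q = q} f s*q<N =
  C.emb ∘ C.cellmate zero zero , f (C.emb zero) ,
  (λ eq → C.cellmate-inj zero zero (C.emb-inj eq)) , (λ a → proj₂ (C.same-cell zero zero a))
  where
  module C = Core (peel s q (λ (_ : Fin 1) → f) s*q<N)

-- The existing bundles use at most `suc q * b` elements, so more than `s * q` are free and some
-- `suc q` of these share a first address.
add-bundle : ∀ {m s b q} {I : Fin m → Fin s} → suc q * (suc b + s) ≤ m →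
             Bundles I (suc q) b → Bundles I (suc q) (suc b)
add-bundle {m} {s} {b} {q} {I} enough B = extend (crowded-fibre (I ∘ elem free) much-free)
  where
  used? : Decidable (λ x → ∃ λ c → ∃ λ β → member B c β ≡ x)
  used? x = any? λ c → any? λ β → member B c β ≟ x
  used = enumerate used?
  free = enumerate (¬? ∘ used?)
  few-used : size used ≤ suc q * b
  few-used = injective⇒≤ {f = λ i → let c , β , _ = sound used i in combine c β} λ {i} {j} eq →
    let c , β , eqᵢ = sound used i ; c′ , β′ , eqⱼ = sound used j
        c≡ , β≡ = combine-injective c β c′ β′ eq in
    injective used (trans (sym eqᵢ) (trans (cong₂ (member B) c≡ β≡) eqⱼ))
  much-free : s * q < size free
  much-free = ℕₚ.+-cancelˡ-< (suc q * b) _ _ (begin-strict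
    suc q * b + s * q         <⟨ ℕₚ.+-monoʳ-< (suc q * b) (s≤s (ℕₚ.m≤n+m (s * q) q)) ⟩
    suc q * b + (suc q + s * q) ≤⟨ ℕₚ.+-monoʳ-≤ (suc q * b) (ℕₚ.+-monoʳ-≤ (suc q)
                                     (ℕₚ.≤-trans (ℕₚ.≤-reflexive (ℕₚ.*-comm s q)) (ℕₚ.m≤n+m (q * s) s))) ⟩
    suc q * b + (suc q + suc q * s) ≡⟨ cong (suc q * b +_) (sym (ℕₚ.*-suc (suc q) s)) ⟩
    suc q * b + suc q * suc s ≡⟨ sym (ℕₚ.*-distribˡ-+ (suc q) b (suc s)) ⟩
    suc q * (b + suc s) ≡⟨ cong (suc q *_) (ℕₚ.+-suc b s) ⟩
    suc q * (suc b + s)        ≤⟨ enough ⟩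
    m                          ≤⟨ size-cover used? used free ⟩
    size used + size free      ≤⟨ ℕₚ.+-monoˡ-≤ (size free) few-used ⟩
    suc q * b + size free      ∎)
    where open ℕₚ.≤-Reasoning
  extend : (∃₂ λ (mate : Fin (suc q) → Fin (size free)) i →
             Injective _≡_ _≡_ mate × (∀ c → I (elem free (mate c)) ≡ i)) →
           Bundles I (suc q) (suc b)
  extend (mate , i , mate-inj , mate-home) = record
    { member = λ { c zero → elem free (mate c) ; c (suc β) → member B c β }
    ; member-inj = λ
        { {β = zero}  {zero}   eq → mate-inj (injective free eq) , refl
        ; {c} {c′} {zero}  {suc β′} eq → contradiction (c′ , β′ , sym eq) (sound free (mate c))
        ; {c} {c′} {suc β} {zero}   eq → contradiction (c , β , eq) (sound free (mate c′))
        ; {β = suc β} {suc β′} eq → let c≡ , β≡ = member-inj B eq in c≡ , cong suc β≡ }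
    ; same-home = λ
        { c c′ zero → trans (mate-home c) (sym (mate-home c′))
        ; c c′ (suc β) → same-home B c c′ β }
    }

bundles : ∀ {m s q} (I : Fin m → Fin s) b → suc q * (b + s) ≤ m → Bundles I (suc q) b
bundles I zero _ = record
  { member = λ _ () ; member-inj = λ { {β = ()} } ; same-home = λ _ _ () }
bundles {q = q} I (suc b) enough =
  add-bundle enough (bundles I b (ℕₚ.≤-trans (ℕₚ.*-monoʳ-≤ (suc q) (ℕₚ.n≤1+n _)) enough))

-- The tree of forced bits under one root value

module ForcingTree
  {m s V δ} {Node : Set} (I : Fin m → Fin s) (J : Bool → Fin m → Fin V) (r : ℕ)
  (root : Node) (home : Node → Fin s)
  (elt : ℕ → Node → Fin m) (I-elt : ∀ t ν → I (elt t ν) ≡ home ν)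
  (elt-inj : ∀ {t t′ ν ν′} → t ≤ r → t′ ≤ r → elt t ν ≡ elt t′ ν′ → t ≡ t′ × ν ≡ ν′)
  (val : ℕ → Bool) (val-suc : ∀ t → t < r → val (suc t) ≡ not (val t))
  (child : ℕ → Node → Fin δ → Node) (child-inj : ∀ t ν → Injective _≡_ _≡_ (child t ν))
  (child-≢ : ∀ t ν a → child t ν a ≢ ν)
  (child-key : ∀ t ν a → J (val t) (elt t (child t ν a)) ≡ J (val t) (elt t ν))
  where

  parent : ∀ t → Fin (δ ^ suc t) → Fin (δ ^ t)
  parent t z = proj₂ (remQuot {δ} (δ ^ t) z)

  branch : ∀ t → Fin (δ ^ suc t) → Fin δ
  branch t z = proj₁ (remQuot {δ} (δ ^ t) z)

  -- Each edge from level `t` to level `suc t` uses the elements `elt t` at both of its ends; they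
  -- share the cell read after `val t`. Storing the upper one and not the lower one forces the
  -- opposite bit at the child.
  vertex : ∀ t → Fin (δ ^ t) → Node
  vertex zero    _ = root
  vertex (suc t) z = child t (vertex t (parent t z)) (branch t z)

  key : ∀ t → Fin (δ ^ t) → Fin V
  key t z = J (val t) (elt t (vertex t z))

  -- The elements to be stored so that the forcing reaches `vertex t z`: one for each proper
  -- ancestor, at that ancestor's level.
  spine : ∀ t → Fin (δ ^ t) → List (Fin m)
  spine zero    _ = []
  spine (suc t) z = elt t (vertex t (parent t z)) ∷ spine t (parent t z)

  length-spine : ∀ t z → length (spine t z) ≡ t
  length-spine zero    z = refl
  length-spine (suc t) z = cong suc (length-spine t (parent t z))

  OnSide : Pred (Fin m) 0ℓ
  OnSide u = ∃ λ t → t ≤ r × ∃ λ ν → u ≡ elt t ν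

  InTree : ℕ → Pred (Fin m) 0ℓ
  InTree t u = ∃ λ t′ → t′ < t × ∃ λ z → u ≡ elt t′ (vertex t′ z)

  ∈-spine : ∀ t z {u} → u ∈ spine t z → InTree t u
  ∈-spine (suc t) z (here refl) = t , ℕₚ.≤-refl , parent t z , refl
  ∈-spine (suc t) z (there u∈) =
    let t′ , t′<t , z′ , eq = ∈-spine t (parent t z) u∈ in t′ , ℕₚ.m<n⇒m<1+n t′<t , z′ , eq

  -- A child shares its level `t` cell with its parent, so it determines the parent's key and hence
  -- the parent; `child-inj` then recovers the branch.
  vertex-inj : ∀ t → Injective _≡_ _≡_ (key t) → Injective _≡_ _≡_ (vertex (suc t))
  vertex-inj t key-inj {z} {z′} eq = begin
    z                                           ≡⟨ combine-remQuot {δ} (δ ^ t) z ⟨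
    combine (branch t z) (parent t z)           ≡⟨ cong₂ combine branch≡ parent≡ ⟩
    combine (branch t z′) (parent t z′)         ≡⟨ combine-remQuot {δ} (δ ^ t) z′ ⟩
    z′                                          ∎
    where
    open ≡-Reasoning
    parent≡ : parent t z ≡ parent t z′
    parent≡ = key-inj (trans (sym (child-key t _ (branch t z)))
      (trans (cong (J (val t) ∘ elt t) eq) (child-key t _ (branch t z′))))
    branch≡ : branch t z ≡ branch t z′
    branch≡ = child-inj t (vertex t (parent t z))
      (trans eq (cong (λ y → child t (vertex t y) (branch t z′)) (sym parent≡)))

  -- Induction along the spine: the parent's element is stored, the child's is not, and they share a
  -- cell, so their first bits cannot both be `val t`.
  propagate : ∀ {T x} → Separates I J T x → ∀ t → t ≤ r → ∀ z → (∀ {u} → u ∈ spine t z → T u) →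
              (∀ t′ → t′ < t → ∀ z′ → ¬ T (elt t′ (vertex (suc t′) z′))) →
              x (home root) ≡ val 0 → x (home (vertex t z)) ≡ val t
  propagate sep zero t≤r z T⁺ T⁻ x₀ = x₀
  propagate {x = x} sep (suc t) t<r z T⁺ T⁻ x₀ = trans
    (Boolₚ.¬-not λ x≡ → sep (val t) (T⁺ (here refl)) (T⁻ t ℕₚ.≤-refl z)
      (trans (cong x (I-elt t _)) ih) (trans (cong x (I-elt t _)) x≡)
      (sym (child-key t _ (branch t z))))
    (sym (val-suc t t<r))
    where
    ih : x (home (vertex t (parent t z))) ≡ val t
    ih = propagate {x = x} sep t (ℕₚ.<⇒≤ t<r) (parent t z) (T⁺ ∘ there)
      (λ t′ t′<t → T⁻ t′ (ℕₚ.m<n⇒m<1+n t′<t)) x₀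

  Collision : ℕ → Set
  Collision t = ∃₂ λ y y′ → y ≢ y′ × key t y ≡ key t y′

  collision? : Decidable Collision
  collision? t = any? λ y → any? λ y′ → ¬? (y ≟ y′) ×-dec (key t y ≟ key t y′)

  no-collision⇒injective : ∀ {t} → ¬ Collision t → Injective _≡_ _≡_ (key t)
  no-collision⇒injective ¬coll {y} {y′} eq =
    decidable-stable (y ≟ y′) λ y≢y′ → ¬coll (y , y′ , y≢y′ , eq)

  -- This keeps the elements that must stay unstored apart from the stored ones. By `elt-inj` the
  -- levels agree, so the child would be a vertex of its parent's level; the shared key makes that
  -- vertex the parent itself, against `child-≢`.
  child∉tree : ∀ {t} → t ≤ r → (∀ {t′} → t′ < t → Injective _≡_ _≡_ (key t′)) →
               ∀ {t₁ t₂} → t₁ < t → t₂ ≤ t → ∀ z₁ z₂ → elt t₁ (vertex (suc t₁) z₁) ≢ elt t₂ (vertex t₂ z₂)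
  child∉tree t≤r key-inj {t₁} t₁<t t₂≤t z₁ z₂ eq
    with elt-inj (ℕₚ.≤-trans (ℕₚ.<⇒≤ t₁<t) t≤r) (ℕₚ.≤-trans t₂≤t t≤r) eq
  ... | refl , vertex≡ = child-≢ t₁ (vertex t₁ (parent t₁ z₁)) (branch t₁ z₁)
    (trans vertex≡ (cong (vertex t₁) (sym (key-inj t₁<t
      (trans (sym (child-key t₁ _ (branch t₁ z₁))) (cong (J (val t₁) ∘ elt t₁) vertex≡))))))

  -- Both ends y, y′ of the first collision are forced to the value val t, so storing the element at
  -- y but not the one at y′ contradicts their common key.
  refute : V < δ ^ r → Refutation I J (2 * r + 1) OnSide (home root) (val 0)
  refute V<δ^r = record
    { members = W ; bounded = length-W ; reserved = W-side
    ; refutes = λ {T} {x} → contradict {T} {x} }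
    where
    first : ∃ λ t → t ≤ r × Collision t × (∀ {t′} → t′ < t → ¬ Collision t′)
    -- At level `r` there are more vertices than cells. Taking the least level with a collision
    -- makes the keys injective on all earlier levels.
    first = least collision? r
      (let y , y′ , y<y′ , eq = pigeonhole V<δ^r (key r) in y , y′ , <⇒≢ y<y′ , eq)
    t = proj₁ first
    t≤r = proj₁ (proj₂ first)
    y = proj₁ (proj₁ (proj₂ (proj₂ first)))
    y′ = proj₁ (proj₂ (proj₁ (proj₂ (proj₂ first))))
    y≢y′ = proj₁ (proj₂ (proj₂ (proj₁ (proj₂ (proj₂ first)))))
    key≡ = proj₂ (proj₂ (proj₂ (proj₁ (proj₂ (proj₂ first)))))
    key-inj : ∀ {t′} → t′ < t → Injective _≡_ _≡_ (key t′)
    key-inj t′<t = no-collision⇒injective (proj₂ (proj₂ (proj₂ first)) t′<t)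
    W = elt t (vertex t y) ∷ spine t y ++ spine t y′
    W-tree : ∀ {u} → u ∈ W → u ≡ elt t (vertex t y) ⊎ InTree t u
    W-tree (here eq) = inj₁ eq
    W-tree (there u∈) = inj₂ ([ ∈-spine t y , ∈-spine t y′ ]′ (∈-++⁻ (spine t y) u∈))
    W-side : ∀ {u} → u ∈ W → OnSide u
    W-side u∈W with W-tree u∈W
    ... | inj₁ eq = t , t≤r , _ , eq
    ... | inj₂ (t′ , t′<t , z , eq) = t′ , ℕₚ.≤-trans (ℕₚ.<⇒≤ t′<t) t≤r , _ , eq
    length-W : length W ≤ 2 * r + 1
    length-W = begin
      suc (length (spine t y ++ spine t y′)) ≡⟨ cong suc (length-++ (spine t y)) ⟩
      suc (length (spine t y) + length (spine t y′)) ≡⟨ cong suc (cong₂ _+_ (length-spine t y) (length-spine t y′)) ⟩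
      suc (t + t) ≤⟨ s≤s (ℕₚ.+-mono-≤ t≤r t≤r) ⟩
      suc (r + r) ≡⟨ ℕₚ.+-comm 1 (r + r) ⟩
      r + r + 1 ≡⟨ cong (λ k → r + k + 1) (sym (ℕₚ.+-identityʳ r)) ⟩
      2 * r + 1 ∎
      where open ℕₚ.≤-Reasoning
    child∉W : ∀ {t′} → t′ < t → ∀ z′ → elt t′ (vertex (suc t′) z′) ∉ W
    child∉W t′<t z′ ∈W with W-tree ∈W
    ... | inj₁ eq = child∉tree t≤r key-inj t′<t ℕₚ.≤-refl z′ y eq
    ... | inj₂ (t″ , t″<t , z , eq) = child∉tree t≤r key-inj t′<t (ℕₚ.<⇒≤ t″<t) z′ z eq
    distinct : ∀ {t} → (∀ {t′} → t′ < t → Injective _≡_ _≡_ (key t′)) → Injective _≡_ _≡_ (vertex t)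
    distinct {zero} _ {zero} {zero} _ = refl
    distinct {suc t} inj = vertex-inj t (inj ℕₚ.≤-refl)
    end∉W : elt t (vertex t y′) ∉ W
    end∉W ∈W with W-tree ∈W
    ... | inj₁ eq = y≢y′ (sym (distinct key-inj (proj₂ (elt-inj t≤r t≤r eq))))
    ... | inj₂ (t′ , t′<t , z , eq) =
      ℕₚ.<⇒≢ t′<t (sym (proj₁ (elt-inj t≤r (ℕₚ.≤-trans (ℕₚ.<⇒≤ t′<t) t≤r) eq)))
    contradict : ∀ {T x} → Separates I J T x → (∀ {u} → u ∈ W → T u) →
                 (∀ {u} → OnSide u → u ∉ W → ¬ T u) → x (home root) ≢ val 0
    contradict {T} {x} sep T⁺ T⁻ x₀ =
      let T⁻-spine : ∀ t′ → t′ < t → ∀ z′ → ¬ T (elt t′ (vertex (suc t′) z′))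
          T⁻-spine t′ t′<t z′ = T⁻ (t′ , ℕₚ.≤-trans (ℕₚ.<⇒≤ t′<t) t≤r , _ , refl) (child∉W t′<t z′)
          T⁻-end : ¬ T (elt t (vertex t y′))
          T⁻-end = T⁻ (t , t≤r , _ , refl) end∉W
          forced : ∀ z → (∀ {u} → u ∈ spine t z → u ∈ W) → x (home (vertex t z)) ≡ val t
          forced z ⊆W = propagate {x = x} sep t t≤r z (λ u∈ → T⁺ (⊆W u∈)) T⁻-spine x₀
      in sep (val t) (T⁺ (here refl)) T⁻-end
           (trans (cong x (I-elt t _)) (forced y (there ∘ ∈-++⁺ˡ)))
           (trans (cong x (I-elt t _)) (forced y′ (there ∘ ∈-++⁺ʳ (spine t y)))) key≡

-- Two forcing trees inside one core

turn : ℕ → Bool → Bool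
turn zero    σ = σ
turn (suc t) σ = not (turn t σ)

-- Each bundle keeps one element in reserve for every pair (root value σ, level t), so the
-- elements occurring in the two refutations never clash.
class : ∀ r → Bool → ℕ → Fin (2 * suc r)
class r σ t = combine (side σ) (t mod suc r)

-- For the class of `σ` and `t` this is the bit forced at level `t` when the root carries `σ`; it
-- selects which second cell of the element counts.
polarity : ∀ r → Fin (2 * suc r) → Bool
polarity r = (λ (σ , t) → turn (toℕ t) (unside σ)) ∘ remQuot {2} (suc r)

toℕ-mod : ∀ {r t} → t ≤ r → toℕ (t mod suc r) ≡ t
toℕ-mod t≤r = trans (toℕ-fromℕ< _) (m<n⇒m%n≡m (s≤s t≤r))

class-injective : ∀ {r σ σ′ t t′} → t ≤ r → t′ ≤ r → class r σ t ≡ class r σ′ t′ → σ ≡ σ′ × t ≡ t′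
class-injective {σ = σ} {σ′} t≤r t′≤r eq =
  let side≡ , mod≡ = combine-injective (side σ) _ (side σ′) _ eq in
  trans (sym (unside-side σ)) (trans (cong unside side≡) (unside-side σ′)) ,
  trans (sym (toℕ-mod t≤r)) (trans (cong toℕ mod≡) (toℕ-mod t′≤r))

polarity-class : ∀ r σ t → t ≤ r → polarity r (class r σ t) ≡ turn t σ
polarity-class r σ t t≤r = trans
  (cong (λ (σ , t) → turn (toℕ t) (unside σ)) (remQuot-combine (side σ) (t mod suc r)))
  (cong₂ turn (toℕ-mod t≤r) (unside-side σ))

module _ {m s V} (r q : ℕ) (I : Fin m → Fin s) (J : Bool → Fin m → Fin V) where

  -- The cell is tagged with the class, so that points meeting in a cell do so through elements of
  -- the same class, as an edge of the tree requires.
  incidence : ∀ {b} → Bundles I (2 * suc r) b → Fin (2 * suc r) → Fin b → Fin (2 * suc r * V)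
  incidence B c β = combine c (J (polarity r c) (member B c β))

  module _ {b} (B : Bundles I (2 * suc r) b) (C : Core q (incidence B)) where
    open Core C

    elt : Bool → ℕ → Fin (suc pred-size) → Fin m
    elt σ t ν = member B (class r σ t) (emb ν)

    elt-side : ∀ {σ σ′ t t′ ν ν′} → t ≤ r → t′ ≤ r → elt σ t ν ≡ elt σ′ t′ ν′ → σ ≡ σ′
    elt-side t≤r t′≤r eq = proj₁ (class-injective t≤r t′≤r (proj₁ (member-inj B eq)))

    elt-injective : ∀ σ {t t′ ν ν′} → t ≤ r → t′ ≤ r → elt σ t ν ≡ elt σ t′ ν′ → t ≡ t′ × ν ≡ ν′
    elt-injective σ t≤r t′≤r eq = let c≡ , β≡ = member-inj B eq in
      proj₂ (class-injective {σ = σ} {σ} t≤r t′≤r c≡) , emb-inj β≡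

    siblings : ∀ σ t ν → Σ (Fin q → Fin (suc q)) λ h →
               Injective _≡_ _≡_ h × (∀ a → cellmate (class r σ t) ν (h a) ≢ ν)
    siblings σ t ν = others (cellmate (class r σ t) ν) (cellmate-inj (class r σ t) ν) ν

    same-key : ∀ c ν a → J (polarity r c) (member B c (emb (cellmate c ν a))) ≡
                         J (polarity r c) (member B c (emb ν))
    same-key c ν a with same-cell c ν a
    ... | c′ , eq with combine-injective c′ _ c _ eq
    ... | refl , key≡ = key≡

    -- The address of class `zero` stands for the address common to the bundle. Both trees start
    -- from the same root, so they refute the two values of a single bit.
    module Tree (σ : Bool) = ForcingTree {δ = q} I J r zero (λ ν → I (member B zero (emb ν)))
      (elt σ) (λ t ν → same-home B (class r σ t) zero (emb ν))
      (elt-injective σ)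
      (polarity r ∘ class r σ)
      (λ t t<r → trans (polarity-class r σ (suc t) t<r)
        (cong not (sym (polarity-class r σ t (ℕₚ.<⇒≤ t<r)))))
      (λ t ν a → cellmate (class r σ t) ν (proj₁ (siblings σ t ν) a))
      (λ t ν eq → proj₁ (proj₂ (siblings σ t ν)) (cellmate-inj (class r σ t) ν eq))
      (λ t ν → proj₂ (proj₂ (siblings σ t ν)))
      (λ t ν a → same-key (class r σ t) ν (proj₁ (siblings σ t ν) a))

    trees-disjoint : ∀ {u} → Tree.OnSide false u → ¬ Tree.OnSide true u
    trees-disjoint (t , t≤r , ν , eq) (t′ , t′≤r , ν′ , eq′) =
      contradiction (elt-side {false} {true} t≤r t′≤r (trans (sym eq) eq′)) λ ()

    core-inseparable : V < q ^ r →
      ∃ λ W → length W ≤ 2 * r + 1 + (2 * r + 1) × (∀ x → ¬ Separates I J (_∈ W) x)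
    core-inseparable V<q^r =
      refute-both (refute false) (refute true) trees-disjoint
      where
      refute : ∀ σ → Refutation I J (2 * r + 1) (Tree.OnSide σ) (I (member B zero (emb zero))) σ
      refute σ = subst (Refutation I J _ _ _) (polarity-class r σ 0 z≤n) (Tree.refute σ V<q^r)

  -- The hypotheses, in order: there is room for `b` bundles; peeling the tagged cells from them
  -- leaves a core; level `r` of a tree has more vertices than there are cells.
  inseparable : ∀ b → 2 * suc r * (b + s) ≤ m → 2 * suc r * V * q < b → V < q ^ r →
                ∃ λ W → length W ≤ 2 * r + 1 + (2 * r + 1) × (∀ x → ¬ Separates I J (_∈ W) x)
  inseparable b enough dense =
    let B = bundles I b enough in core-inseparable B (peel _ q (incidence B) dense)

-- From a two-probe scheme to addresses and cells

∣p∪q∣≤∣p∣+∣q∣ : ∀ {n} (p q : Subset n) → ∣ p ∪ q ∣ ≤ ∣ p ∣ + ∣ q ∣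
∣p∪q∣≤∣p∣+∣q∣ []            []            = z≤n
∣p∪q∣≤∣p∣+∣q∣ (outside ∷ p) (outside ∷ q) = ∣p∪q∣≤∣p∣+∣q∣ p q
∣p∪q∣≤∣p∣+∣q∣ (outside ∷ p) (inside  ∷ q) =
  ℕₚ.≤-trans (s≤s (∣p∪q∣≤∣p∣+∣q∣ p q)) (ℕₚ.≤-reflexive (sym (ℕₚ.+-suc ∣ p ∣ ∣ q ∣)))
∣p∪q∣≤∣p∣+∣q∣ (inside  ∷ p) (outside ∷ q) = s≤s (∣p∪q∣≤∣p∣+∣q∣ p q)
∣p∪q∣≤∣p∣+∣q∣ (inside  ∷ p) (inside  ∷ q) =
  s≤s (ℕₚ.≤-trans (∣p∪q∣≤∣p∣+∣q∣ p q) (ℕₚ.+-monoʳ-≤ ∣ p ∣ (ℕₚ.n≤1+n ∣ q ∣)))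

fromList : ∀ {n} → List (Fin n) → Subset n
fromList = foldr (λ x → ⁅ x ⁆ ∪_) ∅

∣fromList∣≤length : ∀ {n} (xs : List (Fin n)) → ∣ fromList xs ∣ ≤ length xs
∣fromList∣≤length {n} []       = ℕₚ.≤-reflexive (∣⊥∣≡0 n)
∣fromList∣≤length     (x ∷ xs) = ℕₚ.≤-trans (∣p∪q∣≤∣p∣+∣q∣ ⁅ x ⁆ (fromList xs))
  (ℕₚ.+-mono-≤ (ℕₚ.≤-reflexive (∣⁅x⁆∣≡1 x)) (∣fromList∣≤length xs))

∈-fromList⁺ : ∀ {n} {xs : List (Fin n)} {x} → x ∈ xs → x ∈ₛ fromList xs
∈-fromList⁺ {x = x} (here refl) = x∈p∪q⁺ (inj₁ (x∈⁅x⁆ x))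
∈-fromList⁺         (there x∈)  = x∈p∪q⁺ (inj₂ (∈-fromList⁺ x∈))

∈-fromList⁻ : ∀ {n} (xs : List (Fin n)) {x} → x ∈ₛ fromList xs → x ∈ xs
∈-fromList⁻ []       x∈ = contradiction x∈ ∉⊥
∈-fromList⁻ (y ∷ xs) x∈ =
  [ here ∘ x∈⁅y⁆⇒x≡y y , there ∘ ∈-fromList⁻ xs ]′ (x∈p∪q⁻ ⁅ y ⁆ (fromList xs) x∈)

-- A leaf is encoded as a probe at an arbitrary address i with equal answers.
probe : ∀ {s} → Fin s → DTree s → Fin s × Bool × Bool
probe i (leaf b)                   = i , b , b
probe i (node j (leaf a) (leaf b)) = j , a , b
-- A default for trees of depth at least two, which `eval-probe` excludes by its depth bound.
probe i (node j _ _)               = j , false , false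

answer : ∀ {s} → Fin s × Bool × Bool → Vec Bool s → Bool
answer (j , a , b) x = if lookup x j then b else a

eval-probe : ∀ {s} i (T : DTree s) x → depth T ≤ 1 → eval T x ≡ answer (probe i T) x
eval-probe i (leaf b) x _ with lookup x i
... | false = refl
... | true  = refl
eval-probe i (node j (leaf a) (leaf b)) x _ with lookup x j
... | false = refl
... | true  = refl
eval-probe i (node j (leaf _) (node _ _ _)) x (s≤s ())
eval-probe i (node j (node _ _ _) (leaf _)) x (s≤s ())
eval-probe i (node j (node _ _ _) (node _ _ _)) x (s≤s ())

-- A cell consists of the second address and the answers given after each bit, four answer pairs per
-- address. Elements in one cell thus get the same answer once their first bits agree.
code : ∀ {s} → Fin s × Bool × Bool → Fin (s * 4)
code (j , a , b) = combine j (combine (side a) (side b))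

code-injective : ∀ {s} {p p′ : Fin s × Bool × Bool} → code p ≡ code p′ → p ≡ p′
code-injective {p = j , a , b} {j′ , a′ , b′} eq =
  let j≡ , ab≡ = combine-injective j _ j′ _ eq
      a≡ , b≡ = combine-injective (side a) (side b) (side a′) (side b′) ab≡ in
  cong₂ _,_ j≡ (cong₂ _,_ (side-injective a≡) (side-injective b≡))

record Probing (s : ℕ) (T : DTree s) : Set where
  field
    address   : Fin s
    subtree   : Bool → DTree s
    is-node   : T ≡ node address (subtree false) (subtree true)

module _ {m n s} (𝒮 : Scheme m n s 2) where
  open Scheme 𝒮

  tree : Fin m → DTree s
  tree u = proj₁ (query u)

  module _ (1≤n : 1 ≤ n) where

    -- A constant answer would have to be Yes for `⁅ u ⁆` and not Yes for `∅`, both of size at most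
    -- `n`.
    not-leaf : ∀ u b → tree u ≢ leaf b
    not-leaf u b eq = ∉⊥ (to (correct ∅ ∅≤n u) (trans (cong (λ T → eval T (φ ∅ ∅≤n)) eq) b≡true))
      where
      ∅≤n : ∣ ∅ {m} ∣ ≤ n
      ∅≤n = ℕₚ.≤-trans (ℕₚ.≤-reflexive (∣⊥∣≡0 m)) z≤n
      u≤n : ∣ ⁅ u ⁆ ∣ ≤ n
      u≤n = ℕₚ.≤-trans (ℕₚ.≤-reflexive (∣⁅x⁆∣≡1 u)) 1≤n
      b≡true : b ≡ true
      b≡true = trans (sym (cong (λ T → eval T (φ ⁅ u ⁆ u≤n)) eq)) (from (correct ⁅ u ⁆ u≤n u) (x∈⁅x⁆ u))

    probing : ∀ u → Probing s (tree u)
    probing u with tree u in eq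
    ... | leaf b     = contradiction eq (not-leaf u b)
    ... | node i l r = record { address = i ; subtree = λ β → subtreeAt β l r ; is-node = refl }

    address : Fin m → Fin s
    address u = Probing.address (probing u)

    subtree : Bool → Fin m → DTree s
    subtree β u = Probing.subtree (probing u) β

    cell : Bool → Fin m → Fin (s * 4)
    cell β u = code (probe (address u) (subtree β u))

    depth-subtree : ∀ β u → depth (subtree β u) ≤ 1
    depth-subtree β u = go β (subst (λ T → depth T ≤ 2) (Probing.is-node (probing u)) (proj₂ (query u)))
      where
      go : ∀ β → suc (depth (subtree false u) ⊔ depth (subtree true u)) ≤ 2 → depth (subtree β u) ≤ 1
      go false (s≤s d≤1) = ℕₚ.m⊔n≤o⇒m≤o _ _ d≤1
      go true  (s≤s d≤1) = ℕₚ.m⊔n≤o⇒n≤o (depth (subtree false u)) _ d≤1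

    eval-tree : ∀ {β x} u → lookup x (address u) ≡ β → eval (tree u) x ≡ answer (probe (address u) (subtree β u)) x
    eval-tree {β} {x} u eq = begin
      eval (tree u) x
        ≡⟨ cong (λ T → eval T x) (Probing.is-node (probing u)) ⟩
      eval (node (address u) (subtree false u) (subtree true u)) x
        ≡⟨ eval-node (address u) _ _ eq ⟩
      eval (subtreeAt β (subtree false u) (subtree true u)) x
        ≡⟨ cong (λ T → eval T x) (subtreeAt-subtree β) ⟩
      eval (subtree β u) x
        ≡⟨ eval-probe (address u) (subtree β u) x (depth-subtree β u) ⟩
      answer (probe (address u) (subtree β u)) x ∎
      where
      open ≡-Reasoning
      subtreeAt-subtree : ∀ β → subtreeAt β (subtree false u) (subtree true u) ≡ subtree β u
      subtreeAt-subtree false = refl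
      subtreeAt-subtree true  = refl

    -- An element outside `W` with the first bit and the cell of a member would be given the
    -- member's answer.
    scheme-separates : ∀ W → length W ≤ n → ∃ λ x → Separates address cell (_∈ W) x
    scheme-separates W W≤n = lookup x , λ β {u} {v} u∈W v∉W xu xv cell≡ →
      v∉W (∈-fromList⁻ W (to (correct S S≤n v) (begin
        eval (tree v) x                             ≡⟨ eval-tree v xv ⟩
        answer (probe (address v) (subtree β v)) x  ≡⟨ cong (λ p → answer p x) (code-injective cell≡) ⟨
        answer (probe (address u) (subtree β u)) x  ≡⟨ eval-tree u xu ⟨
        eval (tree u) x                             ≡⟨ from (correct S S≤n u) (∈-fromList⁺ u∈W) ⟩
        true                                        ∎)))
      where
      open ≡-Reasoning
      S = fromList W
      S≤n : ∣ S ∣ ≤ n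
      S≤n = ℕₚ.≤-trans (∣fromList∣≤length W) W≤n
      x = φ S S≤n

-- Parameters of the lower bound

module _ {m s r : ℕ} .{{_ : NonZero s}} where

  private
    L c : ℕ
    L = 2 * suc r
    -- In `fits`, the bracket is bounded by `L * s * q` taken 1 + 4 + 1 times: for the extra bundle,
    -- the tagged cells and the addresses.
    c = 6 * (L * L)

    instance
      cs≢0 : NonZero (c * s)
      cs≢0 = ℕₚ.m*n≢0 c s

    q = m / (c * s)

  -- In the constant 8c, a factor 2 pays for q ≥ m / (2cs) and a factor 4 for the number 4s of cells.
  fibre-size : suc (8 * c) ^ suc r * s ^ suc r < m ^ r →
               L * (suc (L * (s * 4) * q) + s) ≤ m × s * 4 < q ^ r
  fibre-size small = fits , exceeds
    where
    open ℕₚ.≤-Reasoning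
    2cs≤8cs : 2 * (c * s) ≤ 8 * c * s
    2cs≤8cs = ℕₚ.≤-trans (ℕₚ.*-monoˡ-≤ (c * s) (ℕₚ.m≤m+n 2 6)) (ℕₚ.≤-reflexive (sym (ℕₚ.*-assoc 8 c s)))
    -- This splits the power: one factor will dominate the number of cells, the other `r` will be
    -- compared with `m` through `m ≤ 2 * (c * s) * q`.
    big : 8 * c * s * (2 * (c * s)) ^ r < m ^ r
    big = begin-strict
      8 * c * s * (2 * (c * s)) ^ r  ≤⟨ ℕₚ.*-monoʳ-≤ (8 * c * s) (ℕₚ.^-monoˡ-≤ r 2cs≤8cs) ⟩
      (8 * c * s) ^ suc r            ≤⟨ ℕₚ.^-monoˡ-≤ (suc r) (ℕₚ.*-monoˡ-≤ s (ℕₚ.n≤1+n (8 * c))) ⟩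
      (suc (8 * c) * s) ^ suc r      ≡⟨ ^-distribʳ-* (suc r) (suc (8 * c)) s ⟩
      suc (8 * c) ^ suc r * s ^ suc r <⟨ small ⟩
      m ^ r                          ∎
    1≤q : 1 ≤ q
    1≤q = m≥n⇒m/n>0 (ℕₚ.≮⇒≥ λ m<cs → ℕₚ.<-irrefl refl (begin-strict
      m ^ r                          ≤⟨ ℕₚ.^-monoˡ-≤ r (ℕₚ.≤-trans (ℕₚ.<⇒≤ m<cs) (ℕₚ.m≤m+n (c * s) (1 * (c * s)))) ⟩
      (2 * (c * s)) ^ r              ≤⟨ ℕₚ.m≤n*m _ (8 * c * s) {{ℕₚ.m*n≢0 (8 * c) s}} ⟩
      8 * c * s * (2 * (c * s)) ^ r  <⟨ big ⟩
      m ^ r                          ∎))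
    m≤2csq : m ≤ 2 * (c * s) * q
    m≤2csq = begin
      m                              ≡⟨ m≡m%n+[m/n]*n m (c * s) ⟩
      _ + q * (c * s)                ≤⟨ ℕₚ.+-monoˡ-≤ (q * (c * s)) (ℕₚ.<⇒≤ (m%n<n m (c * s))) ⟩
      c * s + q * (c * s)            ≤⟨ ℕₚ.+-monoˡ-≤ (q * (c * s)) (ℕₚ.m≤m*n (c * s) q {{>-nonZero 1≤q}}) ⟩
      c * s * q + q * (c * s)        ≡⟨ double (c * s) q ⟩
      2 * (c * s) * q                ∎
      where
      double : ∀ a q → a * q + q * a ≡ 2 * a * q
      double = solve-∀
    4s≤8cs : s * 4 ≤ 8 * c * s
    4s≤8cs = ℕₚ.≤-trans (ℕₚ.≤-reflexive (ℕₚ.*-comm s 4))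
      (ℕₚ.*-monoˡ-≤ s (ℕₚ.≤-trans (ℕₚ.m≤m+n 4 4) (ℕₚ.m≤m*n 8 c)))
    exceeds : s * 4 < q ^ r
    exceeds = ℕₚ.≤-<-trans 4s≤8cs
      (ℕₚ.*-cancelʳ-< _ _ _ (begin-strict
        8 * c * s * (2 * (c * s)) ^ r  <⟨ big ⟩
        m ^ r                          ≤⟨ ℕₚ.^-monoˡ-≤ r m≤2csq ⟩
        (2 * (c * s) * q) ^ r          ≡⟨ ^-distribʳ-* r (2 * (c * s)) q ⟩
        (2 * (c * s)) ^ r * q ^ r      ≡⟨ ℕₚ.*-comm _ (q ^ r) ⟩
        q ^ r * (2 * (c * s)) ^ r      ∎))
    1≤sq : 1 ≤ s * q
    1≤sq = ℕₚ.*-mono-≤ (>-nonZero⁻¹ s) 1≤q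
    fits : L * (suc (L * (s * 4) * q) + s) ≤ m
    fits = begin
      L * (suc (L * (s * 4) * q) + s)             ≤⟨ ℕₚ.*-monoʳ-≤ L (ℕₚ.+-mono-≤
                                                       (ℕₚ.+-monoˡ-≤ (L * (s * 4) * q) 1≤sq)
                                                       (ℕₚ.m≤m*n s q {{>-nonZero 1≤q}})) ⟩
      L * (s * q + L * (s * 4) * q + s * q)       ≤⟨ ℕₚ.*-monoʳ-≤ L (ℕₚ.+-mono-≤
                                                       (ℕₚ.+-monoˡ-≤ _ (ℕₚ.m≤n*m (s * q) L))
                                                       (ℕₚ.m≤n*m (s * q) L)) ⟩
      L * (L * (s * q) + L * (s * 4) * q + L * (s * q)) ≡⟨ collect L s q ⟩
      q * (6 * (L * L) * s)                       ≤⟨ m/n*n≤m m (c * s) ⟩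
      m                                           ∎
      where
      collect : ∀ L s q → L * (L * (s * q) + L * (s * 4) * q + L * (s * q)) ≡ q * (6 * (L * L) * s)
      collect = solve-∀

-- The inequality is the bound raised to the power `n / 4`, with `1 / suc d` in the role of the
-- constant D.
lower-bound : ∀ n → 4 ≤ n → Σ ℕ λ d → Σ ℕ λ M → ∀ m → M ≤ m → ∀ s → Scheme m n s 2 →
              m ^ (n / 4 ∸ 1) ≤ suc d ^ (n / 4) * s ^ (n / 4)
lower-bound n 4≤n with n / 4 in n/4≡ | m≥n⇒m/n>0 {n} {4} 4≤n
... | suc r | _ = 8 * (6 * (2 * suc r * (2 * suc r))) , 1 , λ { (suc m) _ s 𝒮 → bound m s 𝒮 }
  where
  4r+4≤n : 2 * r + 1 + (2 * r + 1) ≤ n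
  4r+4≤n = begin
    2 * r + 1 + (2 * r + 1) ≤⟨ ℕₚ.m≤m+n _ 2 ⟩
    2 * r + 1 + (2 * r + 1) + 2 ≡⟨ collect r ⟩
    suc r * 4 ≡⟨ cong (_* 4) (sym n/4≡) ⟩
    n / 4 * 4 ≤⟨ m/n*n≤m n 4 ⟩
    n ∎
    where
    open ℕₚ.≤-Reasoning
    collect : ∀ r → 2 * r + 1 + (2 * r + 1) + 2 ≡ suc r * 4
    collect = solve-∀
  1≤n : 1 ≤ n
  1≤n = ℕₚ.≤-trans (s≤s z≤n) 4≤n
  bound : ∀ m s → Scheme (suc m) n s 2 → suc m ^ r ≤ suc (8 * (6 * (2 * suc r * (2 * suc r)))) ^ suc r * s ^ suc r
  -- With at least one element there is a first address, so `s` is positive.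
  bound m zero 𝒮 = contradiction (address 𝒮 1≤n zero) λ ()
  bound m s@(suc _) 𝒮 = ℕₚ.≮⇒≥ λ small →
    let fits , exceeds = fibre-size {r = r} small
        W , W≤ , inseparable-W = inseparable r _ (address 𝒮 1≤n) (cell 𝒮 1≤n) _ fits ℕₚ.≤-refl exceeds
        x , sep = scheme-separates 𝒮 1≤n W (ℕₚ.≤-trans W≤ 4r+4≤n)
    in inseparable-W x sep

-- Hypergraphs of large girth

Vertex : ℕ → Set
Vertex q = Fin 3 × Fin q

-- u ↦ (E 0 u , E 1 u , E 2 u) is a tripartite 3-uniform hypergraph; Reach E A v k w says that a walk
-- through k hyperedges, all of them in A, leads from v to w.
data Reach {M q} (E : Fin 3 → Fin M → Fin q) (A : Pred (Fin M) 0ℓ) (v : Vertex q) : ℕ → Vertex q → Set where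
  here : Reach E A v 0 v
  step : ∀ {k c} u c′ → Reach E A v k (c , E c u) → A u → Reach E A v (suc k) (c′ , E c′ u)

-- Equivalently, every cycle has more than r + 1 hyperedges.
Girth : ∀ {M q} → (Fin 3 → Fin M → Fin q) → ℕ → Set
Girth E r = ∀ u {c c′} → c ≢ c′ → ∀ {k} → k ≤ r → ¬ Reach E (_≢ u) (c , E c u) k (c′ , E c′ u)

module _ {M q} {E : Fin 3 → Fin M → Fin q} where

  reach-mono : ∀ {A B : Pred (Fin M) 0ℓ} {v k w} → (∀ {u} → A u → B u) → Reach E A v k w → Reach E B v k w
  reach-mono A⊆B here             = here
  reach-mono A⊆B (step u c′ p a) = step u c′ (reach-mono A⊆B p) (A⊆B a)

  reach-trans : ∀ {A v j w k z} → Reach E A v j w → Reach E A w k z → Reach E A v (k + j) z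
  reach-trans p here             = p
  reach-trans p (step u c′ p′ a) = step u c′ (reach-trans p p′) a

  reach-prepend : ∀ {A k w} c {c′} u → A u → Reach E A (c′ , E c′ u) k w → Reach E A (c , E c u) (suc k) w
  reach-prepend c {c′} u a here             = step u c′ here a
  reach-prepend c u a (step u′ c″ p a′) = step u′ c″ (reach-prepend c u a p) a′

  reach-sym : ∀ {A v k w} → Reach E A v k w → Reach E A w k v
  reach-sym here             = here
  reach-sym (step u c′ p a) = reach-prepend c′ u a (reach-sym p)

reach-map : ∀ {M N q} {E : Fin 3 → Fin M → Fin q} (g : Fin N → Fin M) {A : Pred (Fin N) 0ℓ} {B : Pred (Fin M) 0ℓ} →
            (∀ {u} → A u → B (g u)) → ∀ {v k w} → Reach (λ c → E c ∘ g) A v k w → Reach E B v k w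
reach-map g A⊆B here            = here
reach-map g A⊆B (step u c′ p a) = step (g u) c′ (reach-map g A⊆B p) (A⊆B a)

girth-restrict : ∀ {M N q r} {E : Fin 3 → Fin M → Fin q} (g : Fin N → Fin M) → Injective _≡_ _≡_ g →
                 Girth E r → Girth (λ c → E c ∘ g) r
girth-restrict g g-inj girth u c≢c′ k≤r p = girth (g u) c≢c′ k≤r (reach-map g (_∘ g-inj) p)

extend : ∀ {M q} → (Fin 3 → Fin q) → (Fin 3 → Fin M → Fin q) → Fin 3 → Fin (suc M) → Fin q
extend new E c zero    = new c
extend new E c (suc u) = E c u

Far : ∀ {M q} → (Fin 3 → Fin M → Fin q) → ℕ → Vertex q → Vertex q → Set
Far E r v w = ∀ {k} → k ≤ r → ¬ Reach E U v k w

module _ {M q} {E : Fin 3 → Fin M → Fin q} {new : Fin 3 → Fin q} where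

  -- Only the first and the last visit to the new hyperedge matter.
  reach-extend⁻ : ∀ {A v k w} → Reach (extend new E) A v k w →
    Reach E (A ∘ suc) v k w ⊎
    (A zero × ∃₂ λ c c′ → ∃₂ λ i j → Reach E (A ∘ suc) v i (c , new c) ×
      Reach E (A ∘ suc) (c′ , new c′) j w × j + suc i ≤ k)
  reach-extend⁻ here = inj₁ here
  reach-extend⁻ (step (suc u) c″ p a) with reach-extend⁻ p
  ... | inj₁ p′ = inj₁ (step u c″ p′ a)
  ... | inj₂ (a₀ , c , c′ , i , j , p₁ , p₂ , le) =
    inj₂ (a₀ , c , c′ , i , suc j , p₁ , step u c″ p₂ a , s≤s le)
  reach-extend⁻ (step {c = c} zero c″ p a) with reach-extend⁻ p
  ... | inj₁ p′ = inj₂ (a , c , c″ , _ , 0 , p′ , here , ℕₚ.≤-refl)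
  ... | inj₂ (a₀ , c , c′ , i , j , p₁ , p₂ , le) =
    inj₂ (a , c , c″ , i , 0 , p₁ , here , ℕₚ.m≤n⇒m≤1+n (ℕₚ.≤-trans (ℕₚ.m≤n+m (suc i) j) le))

  -- A walk between two vertices of an old `u` that uses the new hyperedge first reaches it at `d`
  -- and finally leaves it at `d′`. If these agree, the detour is cut out. If not, the outer pieces
  -- joined through `u` connect two vertices of the new hyperedge, `u` replacing it in the length
  -- count.
  girth-extend : ∀ {r} → Girth E r → (∀ {c c′} → c ≢ c′ → Far E r (c , new c) (c′ , new c′)) →
                 Girth (extend new E) r
  girth-extend girth far zero c≢c′ k≤r p with reach-extend⁻ p
  ... | inj₁ p′          = far c≢c′ k≤r (reach-mono _ p′)
  ... | inj₂ (0≢0 , _)   = 0≢0 refl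
  girth-extend girth far (suc u) {c} {c′} c≢c′ k≤r p with reach-extend⁻ p
  ... | inj₁ p′ = girth u c≢c′ k≤r (reach-mono (λ ≢ → ≢ ∘ cong suc) p′)
  ... | inj₂ (_ , d , d′ , i , j , p₁ , p₂ , le) with d ≟ d′
  ...   | yes refl = girth u c≢c′
    (ℕₚ.≤-trans (ℕₚ.+-monoʳ-≤ j (ℕₚ.n≤1+n i)) (ℕₚ.≤-trans le k≤r))
    (reach-mono (λ ≢ → ≢ ∘ cong suc) (reach-trans p₁ p₂))
  ...   | no d≢d′ = far d≢d′ (ℕₚ.≤-trans le k≤r)
    (reach-trans (step u c′ (reach-mono _ (reach-sym p₁)) _) (reach-mono _ (reach-sym p₂)))

length-concatMap : ∀ {A B : Set} (f : A → List B) d → (∀ x → length (f x) ≤ d) →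
                   ∀ xs → length (concatMap f xs) ≤ length xs * d
length-concatMap f d f≤d []       = z≤n
length-concatMap f d f≤d (x ∷ xs) = ℕₚ.≤-trans (ℕₚ.≤-reflexive (length-++ (f x)))
  (ℕₚ.+-mono-≤ (f≤d x) (length-concatMap f d f≤d xs))

-- Balls and vertices of small degree

module _ {M q} (E : Fin 3 → Fin M → Fin q) where

  fibre : ∀ c x → Enumeration (λ u → E c u ≡ x)
  fibre c x = enumerate λ u → E c u ≟ x

  degree : Fin 3 → Fin q → ℕ
  degree c x = size (fibre c x)

  corners : Fin M → List (Vertex q)
  corners u = map (λ c → c , E c u) (allFin 3)

  -- The vertex itself is kept so that balls grow with the radius. Entries may repeat, as only the
  -- length of the list is estimated.
  spread : Vertex q → List (Vertex q)
  spread (c , x) = (c , x) ∷ concatMap (corners ∘ elem (fibre c x)) (allFin (degree c x))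

  ball : ℕ → Vertex q → List (Vertex q)
  ball zero    v = v ∷ []
  ball (suc k) v = concatMap spread (ball k v)

  ball-suc : ∀ {k v w} → w ∈ ball k v → w ∈ ball (suc k) v
  ball-suc = ∈-concatMap⁺ spread ∘ Any.map λ { refl → here refl }

  ball-mono : ∀ {j k v w} → j ≤ k → w ∈ ball j v → w ∈ ball k v
  ball-mono {zero}  {zero}  _ w∈ = w∈
  ball-mono {zero}  {suc k} _ w∈ = ball-suc {k} (ball-mono {zero} {k} z≤n w∈)
  ball-mono {suc j} {suc k} (s≤s j≤k) w∈ = go (ℕₚ.m≤n⇒m<n∨m≡n j≤k)
    where
    go : _ → _
    go (inj₁ j<k) = ball-suc {k} (ball-mono j<k w∈)
    go (inj₂ refl) = w∈

  reach⇒ball : ∀ {A v k w} → Reach E A v k w → w ∈ ball k v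
  reach⇒ball here = here refl
  reach⇒ball {v = v} (step {k} {c} u c′ p a) =
    ∈-concatMap⁺ spread (Any.map (λ { refl → there (∈-concatMap⁺ (corners ∘ elem (fibre c (E c u)))
      (Any.map (λ { refl → subst (λ u′ → (c′ , E c′ u) ∈ corners u′) (sym (proj₂ u∈fibre)) u∈corners })
        (∈-allFin (proj₁ u∈fibre)))) })
      (reach⇒ball p))
    where
    u∈fibre = complete (fibre c (E c u)) {u} refl
    u∈corners : (c′ , E c′ u) ∈ corners u
    u∈corners = ∈-map⁺ (λ c → c , E c u) (∈-allFin c′)

  module _ {d} (deg≤d : ∀ c x → degree c x ≤ d) where

    length-ball : ∀ k v → length (ball k v) ≤ suc (d * 3) ^ k
    length-ball zero    v = ℕₚ.≤-refl
    length-ball (suc k) v = ℕₚ.≤-trans (length-concatMap spread (suc (d * 3)) length-spread (ball k v))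
      (ℕₚ.≤-trans (ℕₚ.*-monoˡ-≤ (suc (d * 3)) (length-ball k v)) (ℕₚ.≤-reflexive (ℕₚ.*-comm _ (suc (d * 3)))))
      where
      length-spread : ∀ v → length (spread v) ≤ suc (d * 3)
      length-spread (c , x) = s≤s (ℕₚ.≤-trans
        (length-concatMap (corners ∘ elem (fibre c x)) 3 (λ _ → ℕₚ.≤-refl) (allFin (degree c x)))
        (ℕₚ.*-monoˡ-≤ 3 (ℕₚ.≤-trans (ℕₚ.≤-reflexive (length-tabulate {n = degree c x} id)) (deg≤d c x))))

    full? : ∀ c → Decidable (λ x → d ≤ degree c x)
    full? c x = d ≤? degree c x

    open-vertices : ∀ c → Enumeration (λ x → ¬ d ≤ degree c x)
    open-vertices c = enumerate (¬? ∘ full? c)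

    -- Distinct full vertices of one colour have disjoint fibres, each with at least `d` hyperedges.
    full-bound : ∀ c → size (enumerate (full? c)) * d ≤ M
    full-bound c = injective⇒≤ {f = λ z → let i , a = remQuot {size full} d z in at i a} λ {z} {z′} eq →
      let i , a = remQuot {size full} d z ; i′ , a′ = remQuot {size full} d z′
          i≡ , a≡ = at-injective i i′ a a′ eq in
      trans (sym (combine-remQuot {size full} d z))
        (trans (cong₂ combine i≡ a≡) (combine-remQuot {size full} d z′))
      where
      full = enumerate (full? c)
      at : Fin (size full) → Fin d → Fin M
      at i a = elem (fibre c (elem full i)) (inject≤ a (sound full i))
      E-at : ∀ i a → E c (at i a) ≡ elem full i
      E-at i a = sound (fibre c (elem full i)) (inject≤ a (sound full i))
      at-injective : ∀ i i′ a a′ → at i a ≡ at i′ a′ → i ≡ i′ × a ≡ a′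
      at-injective i i′ a a′ eq
        with injective full (trans (sym (E-at i a)) (trans (cong (E c) eq) (E-at i′ a′)))
      ... | refl = refl , inject≤-injective _ _ a a′ (injective (fibre c (elem full i)) eq)

    module _ (1≤d : 1 ≤ d) (sparse : 2 * M ≤ q * d) where

      -- By `full-bound` and `sparse`, at most half of the `q` vertices of a colour are full.
      many-open : ∀ c → q ≤ 2 * size (open-vertices c)
      many-open c = ℕₚ.+-cancelˡ-≤ (2 * f) _ _ (begin
        2 * f + q       ≤⟨ ℕₚ.+-monoˡ-≤ q (ℕₚ.*-cancelʳ-≤ _ _ d {{>-nonZero 1≤d}} (begin
          2 * f * d       ≡⟨ ℕₚ.*-assoc 2 f d ⟩
          2 * (f * d)     ≤⟨ ℕₚ.*-monoʳ-≤ 2 (full-bound c) ⟩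
          2 * M           ≤⟨ sparse ⟩
          q * d           ∎)) ⟩
        q + q           ≤⟨ ℕₚ.+-mono-≤ cover cover ⟩
        f + o + (f + o) ≡⟨ arith f o ⟩
        2 * f + 2 * o   ∎)
        where
        open ℕₚ.≤-Reasoning
        f = size (enumerate (full? c))
        o = size (open-vertices c)
        cover : q ≤ f + o
        cover = size-cover (full? c) (enumerate (full? c)) (open-vertices c)
        arith : ∀ f o → f + o + (f + o) ≡ 2 * f + 2 * o
        arith = solve-∀

      -- If all open vertices of colour `c` were bad, their positions in `bad` would be distinct,
      -- making `bad` at least half as long as `q`.
      open-vertex-avoiding : ∀ c (bad : List (Vertex q)) → 2 * length bad < q →
                             ∃ λ x → ¬ d ≤ degree c x × (c , x) ∉ bad
      open-vertex-avoiding c bad few with any? (λ i → ¬? ((c , elem o i) ∈? bad))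
        where
        o = open-vertices c
        open DecMembership (≡-dec {A = Fin 3} {B = λ _ → Fin q} _≟_ _≟_) using (_∈?_)
      ... | yes (i , ∉bad) = elem (open-vertices c) i , sound (open-vertices c) i , ∉bad
      ... | no ∄ = contradiction
        (ℕₚ.≤-trans (many-open c) (ℕₚ.*-monoʳ-≤ 2 (injective⇒≤ {f = index ∘ in-bad} λ {i} {j} eq →
          injective o (,-injectiveʳ (trans (lookup-index (in-bad i))
            (trans (cong (List.lookup bad) eq) (sym (lookup-index (in-bad j)))))))))
        (ℕₚ.<⇒≱ few)
        where
        o = open-vertices c
        open DecMembership (≡-dec {A = Fin 3} {B = λ _ → Fin q} _≟_ _≟_) using (_∈?_)
        in-bad : ∀ i → (c , elem o i) ∈ bad
        in-bad i = decidable-stable ((c , elem o i) ∈? bad) λ ∉bad → ∄ (i , ∉bad)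

-- Greedy construction of a hypergraph of large girth

degree-extend : ∀ {M q d} {E : Fin 3 → Fin M → Fin q} {new} → (∀ c x → degree E c x ≤ d) →
                (∀ c → ¬ d ≤ degree E c (new c)) → ∀ c x → degree (extend new E) c x ≤ d
degree-extend {E = E} {new} deg≤d open-new c x with new c ≟ x
... | yes refl = ℕₚ.≰⇒> (open-new c)
... | no _     = deg≤d c x

High-girth : (M q d r : ℕ) → Set
High-girth M q d r = Σ (Fin 3 → Fin M → Fin q) λ E → (∀ c x → degree E c x ≤ d) × Girth E r

-- The three vertices are chosen in turn, each open and outside the balls of radius `r` around the
-- earlier ones. At most two balls of size `B` are avoided, whence the factor 4 in the hypothesis.
add-hyperedge : ∀ {M q d r} → 1 ≤ d → 4 * suc (d * 3) ^ r < q → 2 * M ≤ q * d →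
                High-girth M q d r → High-girth (suc M) q d r
add-hyperedge {M} {q} {d} {r} 1≤d small-ball sparse (E , deg≤d , girth) =
  extend new E , degree-extend {E = E} {new} deg≤d new-open , girth-extend girth far
  where
  B = suc (d * 3) ^ r
  pick : ∀ c (bad : List (Vertex q)) → length bad ≤ B + B → ∃ λ x → ¬ d ≤ degree E c x × (c , x) ∉ bad
  pick c bad few = open-vertex-avoiding E deg≤d 1≤d sparse c bad
    (ℕₚ.≤-<-trans (ℕₚ.*-monoʳ-≤ 2 few) (ℕₚ.≤-<-trans (ℕₚ.≤-reflexive (arith B)) small-ball))
    where
    arith : ∀ B → 2 * (B + B) ≡ 4 * B
    arith = solve-∀
  first = pick zero [] z≤n
  ball₀ = ball E r (zero , proj₁ first)
  second = pick (suc zero) ball₀ (ℕₚ.≤-trans (length-ball E deg≤d r _) (ℕₚ.m≤m+n B B))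
  ball₁ = ball E r (suc zero , proj₁ second)
  third = pick (suc (suc zero)) (ball₀ ++ ball₁) (ℕₚ.≤-trans (ℕₚ.≤-reflexive (length-++ ball₀))
    (ℕₚ.+-mono-≤ (length-ball E deg≤d r _) (length-ball E deg≤d r _)))
  new : Fin 3 → Fin q
  new zero             = proj₁ first
  new (suc zero)       = proj₁ second
  new (suc (suc zero)) = proj₁ third
  new-open : ∀ c → ¬ d ≤ degree E c (new c)
  new-open zero             = proj₁ (proj₂ first)
  new-open (suc zero)       = proj₁ (proj₂ second)
  new-open (suc (suc zero)) = proj₁ (proj₂ third)
  outside-ball : ∀ {v w} → w ∉ ball E r v → Far E r v w
  outside-ball w∉ k≤r p = w∉ (ball-mono E k≤r (reach⇒ball E p))
  far-sym : ∀ {v w} → Far E r v w → Far E r w v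
  far-sym far k≤r p = far k≤r (reach-sym p)
  far₀₁ = outside-ball (proj₂ (proj₂ second))
  far₀₂ = outside-ball (proj₂ (proj₂ third) ∘ ∈-++⁺ˡ)
  far₁₂ = outside-ball (proj₂ (proj₂ third) ∘ ∈-++⁺ʳ ball₀)
  far : ∀ {c c′} → c ≢ c′ → Far E r (c , new c) (c′ , new c′)
  far {zero}             {zero}             c≢c = contradiction refl c≢c
  far {zero}             {suc zero}         _   = far₀₁
  far {zero}             {suc (suc zero)}   _   = far₀₂
  far {suc zero}         {zero}             _   = far-sym far₀₁
  far {suc zero}         {suc zero}         c≢c = contradiction refl c≢c
  far {suc zero}         {suc (suc zero)}   _   = far₁₂
  far {suc (suc zero)}   {zero}             _   = far-sym far₀₂
  far {suc (suc zero)}   {suc zero}         _   = far-sym far₁₂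
  far {suc (suc zero)}   {suc (suc zero)}   c≢c = contradiction refl c≢c

high-girth : ∀ {q d r} → 1 ≤ d → 4 * suc (d * 3) ^ r < q → ∀ M → 2 * M ≤ q * d → High-girth M q d r
high-girth _   _          zero    _      = (λ _ ()) , (λ _ _ → z≤n) , λ ()
high-girth 1≤d small-ball (suc M) sparse =
  add-hyperedge 1≤d small-ball sparse′ (high-girth 1≤d small-ball M sparse′)
  where sparse′ = ℕₚ.≤-trans (ℕₚ.*-monoʳ-≤ 2 (ℕₚ.n≤1+n M)) sparse

-- Upper bound

-- An infinite walk without backtracking: `h t` and `h (suc t)` meet in their vertex of colour
-- `col t`, and every later hyperedge is left in a colour other than the one it was entered by.
record ReducedWalk {N q} (E : Fin 3 → Fin N → Fin q) (h : ℕ → Fin N) (col : ℕ → Fin 3) : Set where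
  field
    moves  : ∀ t → h (suc t) ≢ h t
    turns  : ∀ t → col (suc t) ≢ col t
    shares : ∀ t → E (col t) (h t) ≡ E (col t) (h (suc t))

open ReducedWalk

drop-walk : ∀ {N q} {E : Fin 3 → Fin N → Fin q} {h col} a →
            ReducedWalk E h col → ReducedWalk E (λ t → h (t + a)) (λ t → col (t + a))
drop-walk a w = record
  { moves = λ t → moves w (t + a) ; turns = λ t → turns w (t + a) ; shares = λ t → shares w (t + a) }

module _ {N q} {E : Fin 3 → Fin N → Fin q} where

  walk-reach : ∀ {h col} → ReducedWalk E h col → ∀ {A : Pred (Fin N) 0ℓ} ℓ → (∀ t → t < suc ℓ → A (h (suc t))) →
               ∀ c → Reach E A (col 0 , E (col 0) (h 0)) (suc ℓ) (c , E c (h (suc ℓ)))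
  walk-reach {h} {col} w zero A c = step (h 1) c
    (subst (λ x → Reach E _ (col 0 , E (col 0) (h 0)) 0 (col 0 , x)) (shares w 0) here) (A 0 (s≤s z≤n))
  walk-reach {h} {col} w (suc ℓ) A c = step (h (suc (suc ℓ))) c
    (subst (λ x → Reach E _ (col 0 , E (col 0) (h 0)) (suc ℓ) (col (suc ℓ) , x)) (shares w (suc ℓ))
      (walk-reach w ℓ (λ t t< → A t (ℕₚ.m<n⇒m<1+n t<)) (col (suc ℓ))))
    (A (suc ℓ) ℕₚ.≤-refl)

  -- A closed walk that returns along its first colour is shortened at its start, one that revisits
  -- h 0 is cut there; what remains joins two vertices of h 0 while avoiding h 0.
  no-closed-walk : ∀ {r} → Girth E r → ∀ b ℓ → ℓ < b → suc ℓ ≤ r → ∀ {h col} → ReducedWalk E h col →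
                   ∀ c → c ≢ col 0 ⊎ 1 ≤ ℓ → E c (h 0) ≢ E c (h (suc ℓ))
  no-closed-walk girth (suc b) ℓ (s≤s ℓ≤b) ℓ<r {h} {col} w c proper closed with c ≟ col 0
  no-closed-walk girth (suc b) zero    ℓ≤b ℓ<r w c (inj₁ c≢) closed | yes c≡ = c≢ c≡
  no-closed-walk girth (suc b) (suc ℓ) (s≤s ℓ≤b) ℓ<r {h} {col} w c proper closed | yes refl =
    no-closed-walk girth b ℓ ℓ≤b (ℕₚ.<⇒≤ ℓ<r) {h ∘ suc} {col ∘ suc}
      (record { moves = moves w ∘ suc ; turns = turns w ∘ suc ; shares = shares w ∘ suc })
      c (inj₁ (turns w 0 ∘ sym)) (trans (sym (shares w 0)) closed)
  ... | no c≢ with ℕₚ.anyUpTo? (λ t → h (suc t) ≟ h 0) (suc ℓ)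
  ...   | no fresh = girth (h 0) (c≢ ∘ sym) ℓ<r
    (subst (λ x → Reach E (_≢ h 0) (col 0 , E (col 0) (h 0)) (suc ℓ) (c , x)) (sym closed)
      (walk-reach w ℓ (λ t t<ℓ eq → fresh (t , t<ℓ , eq)) c))
  ...   | yes (zero , _ , back) = moves w 0 back
  ...   | yes (suc t , s≤s t<ℓ , back) =
    no-closed-walk girth b t (ℕₚ.<-≤-trans t<ℓ ℓ≤b) (ℕₚ.≤-trans t<ℓ (ℕₚ.<⇒≤ ℓ<r)) w (col (suc t)) (proper′ t)
      (trans (cong (E (col (suc t))) (sym back)) (sym (shares w (suc t))))
    where
    proper′ : ∀ t → col (suc t) ≢ col 0 ⊎ 1 ≤ t
    proper′ zero    = inj₁ (turns w 0)
    proper′ (suc t) = inj₂ (s≤s z≤n)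

-- Labels at even positions suffer a collision at distance between 2 and 2ℓ.
no-labelled-walk : ∀ {N q ℓ r} {E : Fin 3 → Fin N → Fin q} → Girth E r → 2 * ℓ ≤ r →
  (lab : Fin N → Fin ℓ) → (∀ {u v} → lab u ≡ lab v → ∃ λ c → E c u ≡ E c v) →
  ∀ {h col} → ¬ ReducedWalk E h col
no-labelled-walk {ℓ = ℓ} {r} {E} girth 2ℓ≤r lab lab-cell {h} {col} w =
  let i , j , i<j , lab≡ = pigeonhole ℕₚ.≤-refl (λ i → lab (h (2 * toℕ {suc ℓ} i)))
      c , cell≡ = lab-cell lab≡
      j≤ℓ = toℕ≤pred[n] j in
  go (toℕ i) (toℕ j) i<j j≤ℓ c cell≡
  where
  go : ∀ i j → i < j → j ≤ ℓ → ∀ c → E c (h (2 * i)) ≢ E c (h (2 * j))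
  go i j i<j j≤ℓ c cell≡ with ℕₚ.m≤n⇒∃[o]m+o≡n i<j
  -- Even positions put the two hyperedges at distance at least two, so `c` may be any colour, even
  -- the one along which the walk sets out.
  ... | o , refl = no-closed-walk girth _ (suc (2 * o)) ℕₚ.≤-refl
    (ℕₚ.≤-trans (ℕₚ.≤-trans (ℕₚ.m≤m+n _ (2 * i)) (ℕₚ.≤-reflexive (arith o i))) (ℕₚ.≤-trans (ℕₚ.*-monoʳ-≤ 2 j≤ℓ) 2ℓ≤r))
    (drop-walk (2 * i) w) c (inj₂ (s≤s z≤n))
    (trans cell≡ (cong (E c ∘ h) (sym (arith o i))))
    where
    arith : ∀ o i → suc (suc (2 * o)) + 2 * i ≡ 2 * (suc i + o)
    arith = solve-∀

-- E 0 addresses the first probe, E 1 and E 2 the second one after reading 0 and 1 respectively.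
second : Bool → Fin 3
second false = suc zero
second true  = suc (suc zero)

second-injective : ∀ {β γ} → second β ≡ second γ → β ≡ γ
second-injective {false} {false} _ = refl
second-injective {true}  {true}  _ = refl

-- Private second cells by removal of leaves

PrivateCells : ∀ {N q} → (Fin 3 → Fin N → Fin q) → (Fin q → Bool) → Set
PrivateCells E x = ∀ {a b} β → x (E zero a) ≡ β → x (E zero b) ≡ β →
                   E (second β) a ≡ E (second β) b → a ≡ b

-- Without an exit, `w` is a leaf: it meets other hyperedges at most in its vertex of colour `c`.
Exit : ∀ {N q} → (Fin 3 → Fin N → Fin q) → Fin N → Fin 3 → Set
Exit E w c = ∃ λ c′ → c′ ≢ c × ∃ λ v → v ≢ w × E c′ w ≡ E c′ v

exit? : ∀ {N q} (E : Fin 3 → Fin N → Fin q) w c → Dec (Exit E w c)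
exit? E w c = any? λ c′ → ¬? (c′ ≟ c) ×-dec any? λ v → ¬? (v ≟ w) ×-dec (E c′ w ≟ E c′ v)

-- Exits are followed forever; the state holds the current hyperedge and the colour by which it was
-- entered.
exits-walk : ∀ {N q} {E : Fin 3 → Fin (suc N) → Fin q} → (∀ w c → Exit E w c) → ∃₂ (ReducedWalk E)
exits-walk {E = E} exit = proj₁ ∘ state , proj₁ ∘ leave ∘ state , record
  { moves  = λ t → proj₁ (proj₂ (proj₂ (proj₂ (leave (state t)))))
  ; turns  = λ t → proj₁ (proj₂ (leave (state (suc t))))
  ; shares = λ t → proj₂ (proj₂ (proj₂ (proj₂ (leave (state t)))))
  }
  where
  leave : ∀ s → Exit E (proj₁ s) (proj₂ s)
  leave (w , c) = exit w c
  state : ℕ → _ × Fin 3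
  state zero    = zero , zero
  state (suc t) = proj₁ (proj₂ (proj₂ (leave (state t)))) , proj₁ (leave (state t))

_[_↦_] : ∀ {q} → (Fin q → Bool) → Fin q → Bool → Fin q → Bool
(x [ y ↦ b ]) z = if does (z ≟ y) then b else x z

update-same : ∀ {q} (x : Fin q → Bool) y {b} → (x [ y ↦ b ]) y ≡ b
update-same x y with y ≟ y
... | yes _   = refl
... | no y≢y = contradiction refl y≢y

update-other : ∀ {q} (x : Fin q → Bool) {y z b} → z ≢ y → (x [ y ↦ b ]) z ≡ x z
update-other x {y} {z} z≢y with z ≟ y
... | yes z≡y = contradiction z≡y z≢y
... | no _    = refl

-- When a hyperedge meets the others in colour c only, its second cells of other colours are private.
steer : ∀ {q} → Fin 3 → Fin q → (Fin q → Bool) → Fin q → Bool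
steer zero             y x = x
steer (suc zero)       y x = x [ y ↦ true ]
steer (suc (suc zero)) y x = x [ y ↦ false ]

module _ {N q} {E : Fin 3 → Fin (suc N) → Fin q} {w c} (no-exit : ¬ Exit E w c) where

  -- If `c` is not `zero`, then `w` shares its first address with no other hyperedge, so the updated
  -- bit concerns `w` alone.
  steer-other : ∀ x {v} → v ≢ w → steer c (E zero w) x (E zero v) ≡ x (E zero v)
  steer-other x {v} v≢w = go c no-exit
    where
    go : ∀ c → ¬ Exit E w c → steer c (E zero w) x (E zero v) ≡ x (E zero v)
    go zero             _       = refl
    go (suc zero)       no-exit = update-other x λ eq → no-exit (zero , (λ ()) , v , v≢w , sym eq)
    go (suc (suc zero)) no-exit = update-other x λ eq → no-exit (zero , (λ ()) , v , v≢w , sym eq)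

  steer-avoids : ∀ x β → steer c (E zero w) x (E zero w) ≡ β → second β ≢ c
  steer-avoids x false eq refl with trans (sym eq) (update-same x (E zero w))
  ... | ()
  steer-avoids x true eq refl with trans (sym eq) (update-same x (E zero w))
  ... | ()

  steer-private : ∀ {x} → PrivateCells (λ c → E c ∘ punchIn w) x → PrivateCells E (steer c (E zero w) x)
  steer-private {x} priv {a} {b} β xa xb cell≡ with a ≟ w | b ≟ w
  ... | yes a≡w  | yes b≡w  = trans a≡w (sym b≡w)
  ... | yes refl | no b≢w   = contradiction (second β , steer-avoids x β xa , b , b≢w , cell≡) no-exit
  ... | no a≢w   | yes refl = contradiction (second β , steer-avoids x β xb , a , a≢w , sym cell≡) no-exit
  ... | no a≢w   | no b≢w   = trans (sym (punch a≢w)) (trans (cong (punchIn w) (priv β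
      (trans (cong (x ∘ E zero) (punch a≢w)) (trans (sym (steer-other x a≢w)) xa))
      (trans (cong (x ∘ E zero) (punch b≢w)) (trans (sym (steer-other x b≢w)) xb))
      (trans (cong (E (second β)) (punch a≢w)) (trans cell≡ (cong (E (second β)) (sym (punch b≢w)))))))
    (punch b≢w))
    where
    punch : ∀ {v} (v≢w : v ≢ w) → punchIn w (punchOut (v≢w ∘ sym)) ≡ v
    punch v≢w = punchIn-punchOut (v≢w ∘ sym)

-- Remove a leaf, solve the rest and steer the leaf to a cell of its own. If there is no leaf, exits
-- yield an infinite reduced walk, which the labels forbid. Labels restrict to the remaining
-- hyperedges, so `ℓ` stays fixed.
private-cells : ∀ {q ℓ r} N {E : Fin 3 → Fin N → Fin q} → Girth E r → 2 * ℓ ≤ r →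
  (lab : Fin N → Fin ℓ) → (∀ {u v} → lab u ≡ lab v → ∃ λ c → E c u ≡ E c v) → ∃ (PrivateCells E)
private-cells zero    girth 2ℓ≤r lab lab-cell = (λ _ → false) , λ { {()} }
private-cells (suc N) {E} girth 2ℓ≤r lab lab-cell with any? (λ w → any? λ c → ¬? (exit? E w c))
... | yes (w , c , no-exit) =
  let x , priv = private-cells N (girth-restrict (punchIn w) (λ {i} {j} → punchIn-injective w i j) girth) 2ℓ≤r
                   (lab ∘ punchIn w) lab-cell in
  steer c (E zero w) x , steer-private no-exit {x} priv
... | no ∄ =
  let h , col , walk = exits-walk {E = E} λ w c → decidable-stable (exit? E w c) λ no-exit → ∄ (w , c , no-exit) in
  contradiction walk (no-labelled-walk girth 2ℓ≤r lab lab-cell)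

-- Separating bits for a stored set

element : ∀ {m} (S : Subset m) → Fin ∣ S ∣ → Fin m
element (outside ∷ S) i       = suc (element S i)
element (inside  ∷ S) zero    = zero
element (inside  ∷ S) (suc i) = suc (element S i)

element-complete : ∀ {m} (S : Subset m) {u} → u ∈ₛ S → ∃ λ i → element S i ≡ u
element-complete (inside  ∷ S) here       = zero , refl
element-complete (inside  ∷ S) (there u∈) = let i , eq = element-complete S u∈ in suc i , cong suc eq
element-complete (outside ∷ S) (there u∈) = let i , eq = element-complete S u∈ in i , cong suc eq

module _ {m n q} {E : Fin 3 → Fin m → Fin q} (girth : Girth E (4 * n)) where

  -- Only the elements that share a second-probe cell with some element of S matter.
  separating-bits : (S : Subset m) → ∣ S ∣ ≤ n → ∃ (Separates (E zero) (E ∘ second) (_∈ₛ S))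
  separating-bits S S≤n = x , λ β {u} {v} u∈S v∉S xu xv cell≡ →
    let t , t≡u = element-complete S u∈S
        a , a≡u = complete near (β , t , cong (E (second β)) (sym t≡u))
        b , b≡v = complete near (β , t , trans (sym cell≡) (cong (E (second β)) (sym t≡u)))
        a≡b = priv β (trans (cong (x ∘ E zero) a≡u) xu) (trans (cong (x ∘ E zero) b≡v) xv)
                (trans (cong (E (second β)) a≡u) (trans cell≡ (cong (E (second β)) (sym b≡v))))
    in v∉S (subst (_∈ₛ S) (trans (sym a≡u) (trans (cong (elem near) a≡b) b≡v)) u∈S)
    where
    Near : Pred (Fin m) 0ℓ
    Near u = ∃ λ β → ∃ λ t → E (second β) u ≡ E (second β) (element S t)
    near? : Decidable Near
    near? u = map′ [ false ,_ , true ,_ ]′ (λ { (false , p) → inj₁ p ; (true , p) → inj₂ p })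
      (near-at? false ⊎-dec near-at? true)
      where
      near-at? : ∀ β → Dec (∃ λ t → E (second β) u ≡ E (second β) (element S t))
      near-at? β = any? λ t → E (second β) u ≟ E (second β) (element S t)
    near = enumerate near?
    -- The label names a second cell of a member of `S` that contains the element. There are two
    -- such cells per member, hence the girth parameter `4 * n`.
    lab : Fin (size near) → Fin (2 * ∣ S ∣)
    lab a = let β , t , _ = sound near a in combine (side β) t
    lab-cell : ∀ {a b} → lab a ≡ lab b → ∃ λ c → E c (elem near a) ≡ E c (elem near b)
    lab-cell {a} {b} eq with sound near a | sound near b
    ... | β , t , p | γ , t′ , p′ with combine-injective (side β) t (side γ) t′ eq
    ...   | side≡ , refl with refl ← side-injective {β} {γ} side≡ = second β , trans p (sym p′)
    4S≤4n : 2 * (2 * ∣ S ∣) ≤ 4 * n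
    4S≤4n = ℕₚ.≤-trans (ℕₚ.≤-reflexive (sym (ℕₚ.*-assoc 2 2 ∣ S ∣))) (ℕₚ.*-monoʳ-≤ 4 S≤n)
    solution = private-cells (size near) (girth-restrict (elem near) (injective near) girth) 4S≤4n lab lab-cell
    x = proj₁ solution
    priv = proj₂ solution

-- The storing scheme built from separating bits

module _ {m n q} {E : Fin 3 → Fin m → Fin q}
         (bits : (S : Subset m) → ∣ S ∣ ≤ n → ∃ (Separates (E zero) (E ∘ second) (_∈ₛ S))) where

  Marked : Subset m → (Fin q → Bool) → Bool → Fin q → Set
  Marked S x β y = ∃ λ u → u ∈ₛ S × x (E zero u) ≡ β × E (second β) u ≡ y

  marked? : ∀ S x β y → Dec (Marked S x β y)
  marked? S x β y = any? λ u → (u ∈ₛ? S) ×-dec (x (E zero u) Boolₚ.≟ β) ×-dec (E (second β) u ≟ y)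

  -- Three tables of `q` bits: the first-probe bits, then for each bit value a table marking the
  -- cells to which some stored element is led.
  bit : Subset m → (Fin q → Bool) → Fin 3 × Fin q → Bool
  bit S x (zero           , y) = x y
  bit S x (suc zero       , y) = does (marked? S x false y)
  bit S x (suc (suc zero) , y) = does (marked? S x true y)

  store : Subset m → (Fin q → Bool) → Vec Bool (3 * q)
  store S x = tabulate (bit S x ∘ remQuot q)

  lookup-store : ∀ S x c y → lookup (store S x) (combine c y) ≡ bit S x (c , y)
  lookup-store S x c y = trans (lookup∘tabulate _ (combine c y)) (cong (bit S x) (remQuot-combine c y))

  cellOf : Bool → Fin m → Fin (3 * q)
  cellOf β u = combine (second β) (E (second β) u)

  probes : Fin m → DTree (3 * q)
  probes u = node (combine {3} zero (E zero u))
    (node (cellOf false u) (leaf false) (leaf true)) (node (cellOf true u) (leaf false) (leaf true))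

  eval-cell : ∀ {s} (i : Fin s) {b} xs → lookup xs i ≡ b → eval (node i (leaf false) (leaf true)) xs ≡ b
  eval-cell i xs eq with lookup xs i
  eval-cell i xs refl | false = refl
  eval-cell i xs refl | true  = refl

  eval-probes : ∀ S x u β → x (E zero u) ≡ β →
                eval (probes u) (store S x) ≡ does (marked? S x β (E (second β) u))
  eval-probes S x u β xu =
    trans (eval-node {β = β} (combine {3} zero (E zero u)) _ _ (trans (lookup-store S x zero (E zero u)) xu)) (go β)
    where
    go : ∀ β → eval (subtreeAt β _ _) (store S x) ≡ does (marked? S x β (E (second β) u))
    go false = eval-cell (cellOf false u) (store S x) (lookup-store S x (suc zero) (E (suc zero) u))
    go true  = eval-cell (cellOf true u) (store S x) (lookup-store S x (suc (suc zero)) (E (suc (suc zero)) u))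

  -- A mark found by a non-member would come from a stored element with the same first bit and the
  -- same cell, which `sep` forbids.
  marked⇔∈ : ∀ S x → Separates (E zero) (E ∘ second) (_∈ₛ S) x → ∀ u →
             (does (marked? S x (x (E zero u)) (E (second (x (E zero u))) u)) ≡ true) ⇔ u ∈ₛ S
  marked⇔∈ S x sep u = mk⇔ only-if λ u∈S → dec-true (marked? S x _ _) (u , u∈S , refl , refl)
    where
    only-if : does (marked? S x (x (E zero u)) (E (second (x (E zero u))) u)) ≡ true → u ∈ₛ S
    only-if eq with marked? S x (x (E zero u)) (E (second (x (E zero u))) u)
    only-if () | no _
    ... | yes (v , v∈S , xv , cell≡) =
      decidable-stable (u ∈ₛ? S) λ u∉S → sep _ v∈S u∉S xv refl cell≡

  scheme : Scheme m n (3 * q) 2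
  scheme = record
    { φ = λ S S≤n → store S (proj₁ (bits S S≤n))
    ; query = λ u → probes u , ℕₚ.≤-refl
    ; correct = λ S S≤n u → let x , sep = bits S S≤n in
        subst (λ b → (b ≡ true) ⇔ u ∈ₛ S) (sym (eval-probes S x u _ refl)) (marked⇔∈ S x sep u)
    }

high-girth-scheme : ∀ {m n q d} → High-girth m q d (4 * n) → Scheme m n (3 * q) 2
high-girth-scheme {n = n} (E , _ , girth) = scheme {E = E} (separating-bits {n = n} {E = E} girth)

-- Parameters of the upper bound

quarter-root : ∀ r m → 4 ^ suc r ≤ m → ∃ λ d → (4 * suc d) ^ suc r ≤ m × m < (4 * suc (suc d)) ^ suc r
quarter-root r m 4^k≤m with least (λ t → m <? (4 * suc t) ^ suc r) m m<
  where
  open ℕₚ.≤-Reasoning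
  m< : m < (4 * suc m) ^ suc r
  m< = begin-strict
    m                      <⟨ ℕₚ.n<1+n m ⟩
    suc m                  ≤⟨ ℕₚ.m≤n*m (suc m) 4 ⟩
    4 * suc m              ≤⟨ ℕₚ.m≤m*n (4 * suc m) ((4 * suc m) ^ r) {{ℕₚ.m^n≢0 (4 * suc m) r}} ⟩
    (4 * suc m) ^ suc r    ∎
-- The least `t` with `(4 * suc t) ^ suc r` above `m` is not `zero` by hypothesis; its predecessor
-- is the `d` sought.
... | zero  , _ , m<4^k , _   = contradiction 4^k≤m (ℕₚ.<⇒≱ m<4^k)
... | suc d , _ , m<    , min = d , ℕₚ.≮⇒≥ (min ℕₚ.≤-refl) , m<

-- d ≈ m^(1/k) / 4 and q ≈ 2m / d, where k = r + 1.
dimensions : ∀ r m → 4 ^ suc r ≤ m → ∃₂ λ q d →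
             1 ≤ d × 4 * suc (d * 3) ^ r < q × 2 * m ≤ q * d × (3 * q) ^ suc r ≤ 72 ^ suc r * m ^ r
dimensions r m 4^k≤m with quarter-root r m 4^k≤m
... | d-1 , root≤m , m<root = q , d , s≤s z≤n , small-ball , ℕₚ.<⇒≤ 2m<qd , size-bound
  where
  open ℕₚ.≤-Reasoning
  d = suc d-1
  -- Rounding up gives `2 * m < q * d`, which serves both the sparsity condition and `small-ball`.
  q = suc (2 * m / d)
  2m<qd : 2 * m < q * d
  2m<qd = begin-strict
    2 * m                            ≡⟨ m≡m%n+[m/n]*n (2 * m) d ⟩
    2 * m % d + 2 * m / d * d        <⟨ ℕₚ.+-monoˡ-< _ (m%n<n (2 * m) d) ⟩
    q * d                            ∎
  1+3d≤4d : suc (d * 3) ≤ 4 * d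
  1+3d≤4d = ℕₚ.≤-trans (ℕₚ.+-monoˡ-≤ (d * 3) (s≤s z≤n)) (ℕₚ.≤-reflexive (arith d))
    where
    arith : ∀ d → d + d * 3 ≡ 4 * d
    arith = solve-∀
  small-ball : 4 * suc (d * 3) ^ r < q
  small-ball = ℕₚ.*-cancelʳ-< d _ _ (begin-strict
    4 * suc (d * 3) ^ r * d          ≤⟨ ℕₚ.*-monoˡ-≤ d (ℕₚ.*-monoʳ-≤ 4 (ℕₚ.^-monoˡ-≤ r 1+3d≤4d)) ⟩
    4 * (4 * d) ^ r * d              ≡⟨ arith d ((4 * d) ^ r) ⟩
    (4 * d) ^ suc r                  ≤⟨ root≤m ⟩
    m                                ≤⟨ ℕₚ.m≤m+n m (1 * m) ⟩
    2 * m                            <⟨ 2m<qd ⟩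
    q * d                            ∎)
    where
    arith : ∀ d p → 4 * p * d ≡ 4 * d * p
    arith = solve-∀
  d≤m : d ≤ m
  d≤m = begin
    d                                ≤⟨ ℕₚ.m≤n*m d 4 ⟩
    4 * d                            ≤⟨ ℕₚ.m≤m*n (4 * d) ((4 * d) ^ r) {{ℕₚ.m^n≢0 (4 * d) r}} ⟩
    (4 * d) ^ suc r                  ≤⟨ root≤m ⟩
    m                                ∎
  sd≤9m : 3 * q * d ≤ 9 * m
  sd≤9m = begin
    3 * q * d                        ≡⟨ ℕₚ.*-assoc 3 q d ⟩
    3 * (d + 2 * m / d * d)          ≤⟨ ℕₚ.*-monoʳ-≤ 3 (ℕₚ.+-mono-≤ d≤m (m/n*n≤m (2 * m) d)) ⟩
    3 * (m + 2 * m)                  ≡⟨ arith m ⟩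
    9 * m                            ∎
    where
    arith : ∀ m → 3 * (m + 2 * m) ≡ 9 * m
    arith = solve-∀
  s = 3 * q
  -- The extra factor `m` is below `(4 * suc d) ^ suc r`, and `s * (8 * d)` is at most 8 times 9
  -- times `m`; this is the origin of 72. One factor `m` then cancels.
  size-bound : s ^ suc r ≤ 72 ^ suc r * m ^ r
  size-bound = ℕₚ.*-cancelʳ-≤ _ _ m {{>-nonZero (ℕₚ.≤-trans (s≤s z≤n) d≤m)}} (begin
    s ^ suc r * m                    ≤⟨ ℕₚ.*-monoʳ-≤ (s ^ suc r) (ℕₚ.<⇒≤ m<root) ⟩
    s ^ suc r * (4 * suc d) ^ suc r  ≤⟨ ℕₚ.*-monoʳ-≤ (s ^ suc r) (ℕₚ.^-monoˡ-≤ (suc r) 4[1+d]≤8d) ⟩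
    s ^ suc r * (8 * d) ^ suc r      ≡⟨ ^-distribʳ-* (suc r) s (8 * d) ⟨
    (s * (8 * d)) ^ suc r            ≤⟨ ℕₚ.^-monoˡ-≤ (suc r) s8d≤72m ⟩
    (72 * m) ^ suc r                 ≡⟨ ^-distribʳ-* (suc r) 72 m ⟩
    72 ^ suc r * (m * m ^ r)         ≡⟨ arith (72 ^ suc r) m (m ^ r) ⟩
    72 ^ suc r * m ^ r * m           ∎)
    where
    arith : ∀ a m p → a * (m * p) ≡ a * p * m
    arith = solve-∀
    4[1+d]≤8d : 4 * suc d ≤ 8 * d
    4[1+d]≤8d = ℕₚ.≤-trans (ℕₚ.*-monoʳ-≤ 4 (ℕₚ.+-monoˡ-≤ d (s≤s z≤n))) (ℕₚ.≤-reflexive (double d))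
      where
      double : ∀ d → 4 * (d + d) ≡ 8 * d
      double = solve-∀
    s8d≤72m : s * (8 * d) ≤ 72 * m
    s8d≤72m = begin
      s * (8 * d)                    ≡⟨ swap s d ⟩
      8 * (s * d)                    ≤⟨ ℕₚ.*-monoʳ-≤ 8 sd≤9m ⟩
      8 * (9 * m)                    ≡⟨ ℕₚ.*-assoc 8 9 m ⟨
      72 * m                         ∎
      where
      swap : ∀ s d → s * (8 * d) ≡ 8 * (s * d)
      swap = solve-∀

-- The inequality is the bound raised to the power `4 * n + 1`; its constant 72 does not depend on
-- `n`.
upper-bound : ∀ n m → 4 ^ suc (4 * n) ≤ m →
              ∃ λ s → Scheme m n s 2 × s ^ (4 * n + 1) ≤ 72 ^ (4 * n + 1) * m ^ (4 * n)
upper-bound n m 4^k≤m rewrite ℕₚ.+-comm (4 * n) 1 =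
  let q , d , 1≤d , small-ball , sparse , size-bound = dimensions (4 * n) m 4^k≤m in
  3 * q , high-girth-scheme {n = n} (high-girth 1≤d small-ball m sparse) , size-bound

theorem2 : (Σ ℕ λ C → (n : ℕ) → Σ ℕ λ M → (m : ℕ) → M ≤ m →
    Σ ℕ λ s → Scheme m (suc n) s 2 ×
    (s ^ (4 * suc n + 1) ≤ (suc C) ^ (4 * suc n + 1) * m ^ (4 * suc n)))
    ×
    ((n : ℕ) → 4 ≤ n → Σ ℕ λ d → Σ ℕ λ M → (m : ℕ) → M ≤ m →
    (s : ℕ) → Scheme m n s 2 →
    m ^ (n / 4 ∸ 1) ≤ (suc d) ^ (n / 4) * s ^ (n / 4))
theorem2 = (71 , λ n → 4 ^ suc (4 * suc n) , upper-bound (suc n)) , lower-bound
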